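{- There is no regular graph of odd degree $d\ge3$, diameter $D\equiv 0\pmod 6$, and cyclic defect.
   Context: For an integer $d\ge 1$ define polynomials $G_{d,m}(x)$ by $G_{d,0}(x)=1$, $G_{d,1}(x)=x+1$, and $G_{d,m+1}(x)=xG_{d,m}(x)-(d-1)G_{d,m-1}(x)$ for $m\ge1$. Let $J_n$ be the $n\times n$ all-ones matrix. For a graph on $n\ge3$ vertices, a cycle matrix is the adjacency matrix $B$ of an $n$-cycle on the same vertex set (i.e., for some ordering $v_1,\dots,v_n$ of the vertices, $B_{ij}=1$ iff $v_i,v_j$ are cyclically consecutive, and $0$ otherwise); this cycle need not consist of edges of the graph. A graph $\Gamma$ of order $n$ with adjacency matrix $A$ is a graph of degree $d$, diameter $D$ and cyclic defect if $\Gamma$ is $d$-regular with $d\ge3$, has diameter $D\ge2$, and $G_{d,D}(A)=J_n+B$ for some cycle matrix $B$. -}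

module Defs where

open import Data.Nat as ℕ using (ℕ; zero; suc; _≤_; _<_; _%_)
open import Data.Integer as ℤ using (ℤ; +_; _-_)
open import Data.Fin using (Fin; zero; suc; toℕ)
open import Data.Fin.Permutation using (Permutation′; _⟨$⟩ʳ_)
open import Data.Bool using (Bool; true; false; if_then_else_)
open import Data.Product using (Σ; _×_; ∃; ∃-syntax; _,_)
open import Data.Sum using (_⊎_)
open import Relation.Binary.PropositionalEquality using (_≡_)
open import Relation.Nullary using (¬_)

sumℕ : ∀ {n} → (Fin n → ℕ) → ℕ
sumℕ {zero}  f = 0
sumℕ {suc n} f = f zero ℕ.+ sumℕ (λ i → f (suc i))

sumℤ : ∀ {n} → (Fin n → ℤ) → ℤ
sumℤ {zero}  f = + 0
sumℤ {suc n} f = f zero ℤ.+ sumℤ (λ i → f (suc i))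

Mat : ℕ → Set
Mat n = Fin n → Fin n → ℤ

_⊕_ : ∀ {n} → Mat n → Mat n → Mat n
(M ⊕ N) i j = M i j ℤ.+ N i j

_⊝_ : ∀ {n} → Mat n → Mat n → Mat n
(M ⊝ N) i j = M i j - N i j

_⊛_ : ∀ {n} → Mat n → Mat n → Mat n
(M ⊛ N) i j = sumℤ (λ k → M i k ℤ.* N k j)

scale : ∀ {n} → ℤ → Mat n → Mat n
scale c M i j = c ℤ.* M i j

idM : ∀ {n} → Mat n
idM {n} i j with toℕ i ℕ.≟ toℕ j
... | Relation.Nullary.yes _ = + 1
... | Relation.Nullary.no  _ = + 0

onesM : ∀ {n} → Mat n
onesM i j = + 1

record Graph (n : ℕ) : Set where
  field
    adj   : Fin n → Fin n → Bool
    sym   : ∀ i j → adj i j ≡ adj j i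
    irrefl : ∀ i → adj i i ≡ false
open Graph public

b2ℤ : Bool → ℤ
b2ℤ b = if b then + 1 else + 0

b2ℕ : Bool → ℕ
b2ℕ b = if b then 1 else 0

adjMat : ∀ {n} → Graph n → Mat n
adjMat Γ i j = b2ℤ (adj Γ i j)

degree : ∀ {n} → Graph n → Fin n → ℕ
degree Γ i = sumℕ (λ j → b2ℕ (adj Γ i j))

Regular : ∀ {n} → Graph n → ℕ → Set
Regular Γ d = ∀ i → degree Γ i ≡ d

data Walk {n} (Γ : Graph n) : ℕ → Fin n → Fin n → Set where
  here : ∀ {i} → Walk Γ 0 i i
  step : ∀ {k i l j} → adj Γ i l ≡ true → Walk Γ k l j → Walk Γ (suc k) i j

DistLE : ∀ {n} → Graph n → ℕ → Fin n → Fin n → Set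
DistLE Γ D i j = ∃[ k ] (k ≤ D × Walk Γ k i j)

Diameter : ∀ {n} → Graph n → ℕ → Set
Diameter Γ D =
  (∀ i j → DistLE Γ D i j) ×
  (∃[ i ] ∃[ j ] (∀ k → Walk Γ k i j → D ≤ k))

GMat : ∀ {n} → ℕ → ℕ → Mat n → Mat n
GMat d zero A = idM
GMat d (suc zero) A = A ⊕ idM
GMat d (suc (suc m)) A =
  (A ⊛ GMat d (suc m) A) ⊝ scale (+ (d ℕ.∸ 1)) (GMat d m A)

cycAdj : ∀ {n} → Fin n → Fin n → Bool
cycAdj {n} i j with n
... | zero = false
... | suc m with (suc (toℕ i) % suc m) ℕ.≟ toℕ j | (suc (toℕ j) % suc m) ℕ.≟ toℕ i
...   | Relation.Nullary.yes _ | _ = true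
...   | Relation.Nullary.no _ | Relation.Nullary.yes _ = true
...   | Relation.Nullary.no _ | Relation.Nullary.no _ = false

IsCycleMatrix : ∀ {n} → Mat n → Set
IsCycleMatrix {n} B =
  Σ (Permutation′ n) λ π → (∀ x y → B x y ≡ b2ℤ (cycAdj (π ⟨$⟩ʳ x) (π ⟨$⟩ʳ y)))

CyclicDefect : ∀ {n} → Graph n → ℕ → ℕ → Set
CyclicDefect {n} Γ d D =
  3 ≤ n × Regular Γ d × 3 ≤ d × 2 ≤ D × Diameter Γ D ×
  ∃[ B ] (IsCycleMatrix B × (∀ i j → GMat d D (adjMat Γ) i j ≡ (onesM ⊕ B) i j))

{-# OPTIONS --safe #-}
module Submission where

open import Defs hiding (sym)
open import Data.Nat as ℕ using (ℕ; zero; suc; _%_; _/_; _≤_; s≤s)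
import Data.Nat.Properties as ℕₚ
open import Data.Nat.DivMod using (m%n<n; m<n⇒m%n≡m; m≡m%n+[m/n]*n; [m+n]%n≡m%n; m%n%n≡m%n; %-distribˡ-+)
open import Data.Bool using (Bool; true; false)
open import Data.Empty using (⊥; ⊥-elim)
open import Data.Fin using (Fin; zero; suc; toℕ; fromℕ<)
open import Data.Fin.Permutation using (Permutation′; _⟨$⟩ʳ_; _⟨$⟩ˡ_; inverseˡ; inverseʳ)
open import Data.Fin.Properties using (toℕ-injective; toℕ-fromℕ<; toℕ<n)
open import Data.Integer as ℤ using (ℤ; +_; -[1+_]; _+_; _*_; _-_; -_; _^_; ∣_∣)
open import Data.Integer.DivMod using (_/ℕ_; _%ℕ_; a≡a%ℕn+[a/ℕn]*n; n%ℕd<d)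
open import Data.Integer.Properties as ℤₚ using (i≡j⇒i-j≡0; i*j≡0⇒i≡0∨j≡0)
open import Data.Integer.Tactic.RingSolver using (solve-∀)
open import Data.Product using (∃; _×_; _,_; proj₁; proj₂)
open import Data.Sum using (_⊎_; inj₁; inj₂)
open import Function using (_∘_)
open import Relation.Binary.PropositionalEquality
open import Relation.Nullary using (¬_; yes; no)
open import Relation.Nullary.Negation using (contradiction)

-- Write q = d − 1 = 2s. The all-ones vector gives G(d) = n + 2, and G(d) ≡ 2 (mod 4), so 4 ∣ n
-- and the n-cycle B has the eigenvector (−1)^i for −2 and the kernel spanned by cos(iπ/2), sin(iπ/2).
-- A commutes with B, so A acts on these spaces: by an integer λ = −d + 2t with G(λ) = −2, and by an
-- integer 2×2 matrix M with G(M) = 0. Here t counts neighbours in the same parity class of the cycle,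
-- whence M ≡ ((t, d−t), (d−t, t)) (mod 2).
--
-- Let H be the divided difference of G, so that G(x) − G(μ) = (x − μ) H(μ, x). Since G(−d) = q^D is
-- divisible by 64, G(λ) = −2 forces t to be odd. Then M and H(−d, M) are both ≡ I (mod 2), and
-- (M + d) H(−d, M) = −q^D yields M ≡ −d (mod 64). On the other hand (M − λ) H(λ, M) = 2, so
-- det(M − λ) divides 4; as it is 4 (t² + 16w), this gives t ≡ ±1 (mod 8). But for even D
-- H(−d, λ) ≡ 1 (mod 4) if t ≡ 1 (mod 4), and H(−d, λ) ≡ 5 (mod 8) if t ≡ −1 (mod 8), which is
-- incompatible with −2 = q^D + 2 t H(−d, λ).

-- Integers modulo powers of two

parity : ∀ x → (∃ λ k → x ≡ + 2 * k) ⊎ (∃ λ k → x ≡ + 1 + + 2 * k)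
parity x with x %ℕ 2 | n%ℕd<d x 2 | a≡a%ℕn+[a/ℕn]*n x 2
... | 0 | _ | eq = inj₁ (x /ℕ 2 , trans eq (lemma (x /ℕ 2)))
  where
  lemma : ∀ k → + 0 + k * + 2 ≡ + 2 * k
  lemma = solve-∀
... | 1 | _ | eq = inj₂ (x /ℕ 2 , trans eq (lemma (x /ℕ 2)))
  where
  lemma : ∀ k → + 1 + k * + 2 ≡ + 1 + + 2 * k
  lemma = solve-∀
... | suc (suc _) | s≤s (s≤s ()) | _

odd≢0 : ∀ k → + 1 + + 2 * k ≢ + 0
odd≢0 k eq with ℕₚ.m*n≡1⇒m≡1 2 ∣ - k ∣
  (trans (sym (ℤₚ.abs-* (+ 2) (- k))) (cong ∣_∣ (trans (lemma k) (cong (λ w → + 1 - w) eq))))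
  where
  lemma : ∀ k → + 2 * - k ≡ + 1 - (+ 1 + + 2 * k)
  lemma = solve-∀
... | ()

-- Congruence contradictions are brought to this form: the difference of the two sides of an
-- impossible equation is rewritten as 2, 4 or 8 (`n` = 1, 3, 7) times an odd number.
oddMultiple≢0 : ∀ n k → + suc n * (+ 1 + + 2 * k) ≢ + 0
oddMultiple≢0 n k eq with i*j≡0⇒i≡0∨j≡0 (+ suc n) eq
... | inj₂ odd≡0 = odd≢0 k odd≡0

unit : ∀ i j → i * j ≡ + 1 → i ≡ + 1 ⊎ i ≡ - + 1
unit i j eq with i | ℕₚ.m*n≡1⇒m≡1 ∣ i ∣ ∣ j ∣ (trans (sym (ℤₚ.abs-* i j)) (cong ∣_∣ eq))
... | + .1       | refl = inj₁ refl
... | -[1+ .0 ] | refl = inj₂ refl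

-- (1+2κ)(1−2κ)(1+4κ²)(1+16κ⁴) = 1 − 256κ⁸ inverts 1 + 2κ modulo 64.
cancelOdd₆₄ : ∀ x y κ → (+ 1 + + 2 * κ) * x ≡ + 64 * y → ∃ λ z → x ≡ + 64 * z
cancelOdd₆₄ x y κ eq =
  inv (κ * κ) * y + + 4 * x * κ⁸ ,
  trans (split x κ) (trans (cong (λ w → inv (κ * κ) * w + + 64 * (+ 4 * x * κ⁸)) eq)
                           (collect (inv (κ * κ)) y (+ 4 * x * κ⁸)))
  where
  κ⁸ : ℤ
  κ⁸ = (κ * κ) * (κ * κ) * ((κ * κ) * (κ * κ))

  inv : ℤ → ℤ
  inv κ² = (+ 1 - + 2 * κ) * (+ 1 + + 4 * κ²) * (+ 1 + + 16 * (κ² * κ²))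

  split : ∀ x κ → x ≡ (+ 1 - + 2 * κ) * (+ 1 + + 4 * (κ * κ)) * (+ 1 + + 16 * ((κ * κ) * (κ * κ)))
                          * ((+ 1 + + 2 * κ) * x)
                        + + 64 * (+ 4 * x * ((κ * κ) * (κ * κ) * ((κ * κ) * (κ * κ))))
  split = solve-∀

  collect : ∀ i y w → i * (+ 64 * y) + + 64 * w ≡ + 64 * (i * y + w)
  collect = solve-∀

-- An odd square is 1 modulo 4, which excludes -1. For +1 one has t² ≡ 1 (mod 16), whereas t ≡ ±3
-- (mod 8) gives t² ≡ 9. The residue 1 modulo 8 is recorded only modulo 4, the form that `h≡1mod4`
-- takes.
oddSquareNearUnit : ∀ u w → let t = + 1 + + 2 * u in
  t * t + + 16 * w ≡ + 1 ⊎ t * t + + 16 * w ≡ - + 1 →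
  (∃ λ j → t ≡ + 1 + + 4 * j) ⊎ (∃ λ j → t ≡ - + 1 + + 8 * j)
oddSquareNearUnit u w (inj₂ eq) = ⊥-elim (oddMultiple≢0 1 (u * u + u + + 4 * w)
  (trans (lemma u w) (i≡j⇒i-j≡0 eq)))
  where
  lemma : ∀ u w → + 2 * (+ 1 + + 2 * (u * u + u + + 4 * w))
                    ≡ (+ 1 + + 2 * u) * (+ 1 + + 2 * u) + + 16 * w - - + 1
  lemma = solve-∀
oddSquareNearUnit u w (inj₁ eq) with parity u
oddSquareNearUnit u w (inj₁ eq) | inj₁ (v , refl) with parity v
... | inj₁ (j , refl) = inj₁ (+ 2 * j , lemma j)
  where
  lemma : ∀ j → + 1 + + 2 * (+ 2 * (+ 2 * j)) ≡ + 1 + + 4 * (+ 2 * j)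
  lemma = solve-∀
... | inj₂ (j , refl) = ⊥-elim (oddMultiple≢0 7 (j + v * v + w) (trans (lemma j w) (i≡j⇒i-j≡0 eq)))
  where
  lemma : ∀ j w → let v = + 1 + + 2 * j; t = + 1 + + 2 * (+ 2 * v) in
    + 8 * (+ 1 + + 2 * (j + v * v + w)) ≡ t * t + + 16 * w - + 1
  lemma = solve-∀
oddSquareNearUnit u w (inj₁ eq) | inj₂ (v , refl) with parity v
... | inj₂ (j , refl) = inj₂ (+ 1 + j , lemma j)
  where
  lemma : ∀ j → + 1 + + 2 * (+ 1 + + 2 * (+ 1 + + 2 * j)) ≡ - + 1 + + 8 * (+ 1 + j)
  lemma = solve-∀
... | inj₁ (j , refl) = ⊥-elim (oddMultiple≢0 7 (+ 3 * j + + 4 * j * j + w) (trans (lemma j w) (i≡j⇒i-j≡0 eq)))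
  where
  lemma : ∀ j w → let t = + 1 + + 2 * (+ 1 + + 2 * (+ 2 * j)) in
    + 8 * (+ 1 + + 2 * (+ 3 * j + + 4 * j * j + w)) ≡ t * t + + 16 * w - + 1
  lemma = solve-∀

-- The polynomials G and their divided differences

module _ (q : ℤ) where

  g : ℤ → ℕ → ℤ
  g x 0             = + 1
  g x 1             = x + + 1
  g x (suc (suc m)) = x * g x (suc m) - q * g x m

  -- The divided difference (g x m − g μ m) / (x − μ).
  h : ℤ → ℤ → ℕ → ℤ
  h μ x 0             = + 0
  h μ x 1             = + 1
  h μ x (suc (suc m)) = x * h μ x (suc m) + g μ (suc m) - q * h μ x m

  -- Writing x · G(μ) = μ · G(μ) + (x - μ) · G(μ) in the recurrence of `g x` produces the
  -- inhomogeneous term `g μ (suc m)` in the recurrence of `h`.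
  g-difference : ∀ μ x m → g x m ≡ g μ m + (x - μ) * h μ x m
  g-difference μ x 0 = lemma μ x
    where
    lemma : ∀ μ x → + 1 ≡ + 1 + (x - μ) * + 0
    lemma = solve-∀
  g-difference μ x 1 = lemma μ x
    where
    lemma : ∀ μ x → x + + 1 ≡ μ + + 1 + (x - μ) * + 1
    lemma = solve-∀
  g-difference μ x (suc (suc m)) = trans
    (cong₂ (λ a b → x * a - q * b) (g-difference μ x (suc m)) (g-difference μ x m))
    (lemma μ x q (g μ (suc m)) (g μ m) (h μ x (suc m)) (h μ x m))
    where
    lemma : ∀ μ x q G₁ G₀ H₁ H₀ → x * (G₁ + (x - μ) * H₁) - q * (G₀ + (x - μ) * H₀)
              ≡ μ * G₁ - q * G₀ + (x - μ) * (x * H₁ + G₁ - q * H₀)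
    lemma = solve-∀

  -- At x = -(1 + q) the characteristic polynomial of the recurrence is (X + 1)(X + q), and the
  -- initial values 1, -q single out the root -q.
  g[-d] : ∀ m → g (- (+ 1 + q)) m ≡ (- q) ^ m
  g[-d] 0 = refl
  g[-d] 1 = lemma q
    where
    lemma : ∀ q → - (+ 1 + q) + + 1 ≡ - q * + 1
    lemma = solve-∀
  g[-d] (suc (suc m)) = trans
    (cong₂ (λ a b → - (+ 1 + q) * a - q * b) (g[-d] (suc m)) (g[-d] m))
    (lemma q ((- q) ^ m))
    where
    lemma : ∀ q P → - (+ 1 + q) * (- q * P) - q * P ≡ - q * (- q * P)
    lemma = solve-∀

-- The recurrence preserves the residue 2 because d - q = 1. Since G₁ = 2 + 2s may be 0 modulo 4,
-- degree 3 is a second base case; there q · G₁ = 2s(2 + 2s) vanishes modulo 4.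
g[d]≡2mod4 : ∀ s m → ∃ λ k → g (+ 2 * s) (+ 1 + + 2 * s) (suc (suc m)) ≡ + 2 + + 4 * k
g[d]≡2mod4 s 0 = s + s * s , lemma s
  where
  lemma : ∀ s → (+ 1 + + 2 * s) * (+ 1 + + 2 * s + + 1) - + 2 * s * + 1 ≡ + 2 + + 4 * (s + s * s)
  lemma = solve-∀
g[d]≡2mod4 s 1 with g[d]≡2mod4 s 0
... | k , eq = k + + 2 * s * k - s * s ,
  trans (cong (λ a → (+ 1 + + 2 * s) * a - + 2 * s * (+ 1 + + 2 * s + + 1)) eq) (lemma s k)
  where
  lemma : ∀ s k → (+ 1 + + 2 * s) * (+ 2 + + 4 * k) - + 2 * s * (+ 1 + + 2 * s + + 1)
            ≡ + 2 + + 4 * (k + + 2 * s * k - s * s)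
  lemma = solve-∀
g[d]≡2mod4 s (suc (suc m)) with g[d]≡2mod4 s (suc m) | g[d]≡2mod4 s m
... | k , eq | l , eq′ = k + + 2 * s * k - + 2 * s * l ,
  trans (cong₂ (λ a b → (+ 1 + + 2 * s) * a - + 2 * s * b) eq eq′) (lemma s k l)
  where
  lemma : ∀ s k l → (+ 1 + + 2 * s) * (+ 2 + + 4 * k) - + 2 * s * (+ 2 + + 4 * l)
            ≡ + 2 + + 4 * (k + + 2 * s * k - + 2 * s * l)
  lemma = solve-∀

cong₃ : ∀ {A B C D : Set} (f : A → B → C → D) {x x′ y y′ z z′} →
        x ≡ x′ → y ≡ y′ → z ≡ z′ → f x y z ≡ f x′ y′ z′
cong₃ f refl refl refl = refl

module _ (s t : ℤ) where
  private
    q = + 2 * s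
    μ = - (+ 1 + q)
    x = μ + + 2 * t

  -- The cofactor H(-d, λ) in G(λ) = G(-d) + 2t · H(-d, λ), where λ = -d + 2t is the `x` above.
  h[-d] : ℕ → ℤ
  h[-d] = h q μ x

-- Modulo 4, x ≡ 1 - q and the inhomogeneous term (-q)^(m+2) vanishes, so two values 1 are followed
-- by (1 - q) - q = 1 - 4s ≡ 1.
h≡1mod4 : ∀ s j m → ∃ λ k → h[-d] s (+ 1 + + 4 * j) (suc m) ≡ + 1 + + 4 * k
h≡1mod4 s j 0 = + 0 , refl
h≡1mod4 s j 1 = + 2 * j - s , lemma s j
  where
  lemma : ∀ s j → let q = + 2 * s; μ = - (+ 1 + q); x = μ + + 2 * (+ 1 + + 4 * j) in
    x * + 1 + (μ + + 1) - q * + 0 ≡ + 1 + + 4 * (+ 2 * j - s)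
  lemma = solve-∀
h≡1mod4 s j (suc (suc m)) with h≡1mod4 s j (suc m) | h≡1mod4 s j m
... | k , eq | l , eq′ =
  (+ 2 * j - s + (+ 1 - + 2 * s + + 8 * j) * k + s * s * (- q) ^ m - + 2 * s * l) ,
  trans (cong₃ (λ u v w → x * u + v - q * w) eq (g[-d] q (suc (suc m))) eq′)
        (lemma s j k l ((- q) ^ m))
  where
  q = + 2 * s
  x = - (+ 1 + q) + + 2 * (+ 1 + + 4 * j)

  lemma : ∀ s j k l P → let q = + 2 * s; x = - (+ 1 + q) + + 2 * (+ 1 + + 4 * j) in
    x * (+ 1 + + 4 * k) + - q * (- q * P) - q * (+ 1 + + 4 * l)
      ≡ + 1 + + 4 * (+ 2 * j - s + (+ 1 - + 2 * s + + 8 * j) * k + s * s * P - + 2 * s * l)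
  lemma = solve-∀

-- Modulo 8, x ≡ -3 - 2s and powers of -q from the third on vanish; the recurrence then alternates
-- between 1 + 4s at odd and 5 at even indices. With the index written as `k ℕ.* 2`, passing from
-- `k` to `suc k` unfolds to two steps of the recurrence.
h≡5mod8 : ∀ s j k → (∃ λ b → h[-d] s (- + 1 + + 8 * j) (3 ℕ.+ k ℕ.* 2) ≡ + 1 + + 4 * s + + 8 * b)
                  × (∃ λ a → h[-d] s (- + 1 + + 8 * j) (4 ℕ.+ k ℕ.* 2) ≡ + 5 + + 8 * a)
h≡5mod8 s j 0 = h₃ , h₄
  where
  q = + 2 * s
  μ = - (+ 1 + q)
  x = μ + + 2 * (- + 1 + + 8 * j)

  -- `h₃′` leaves the term 12 s²; since s² ≡ s (mod 2), it is ≡ 12 s ≡ 4 s (mod 8).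
  r : ∃ λ r → s * s ≡ s + + 2 * r
  r with parity s
  ... | inj₁ (v , refl) = + 2 * v * v - v , lemma v
    where
    lemma : ∀ v → + 2 * v * (+ 2 * v) ≡ + 2 * v + + 2 * (+ 2 * v * v - v)
    lemma = solve-∀
  ... | inj₂ (v , refl) = v + + 2 * v * v , lemma v
    where
    lemma : ∀ v → (+ 1 + + 2 * v) * (+ 1 + + 2 * v) ≡ + 1 + + 2 * v + + 2 * (v + + 2 * v * v)
    lemma = solve-∀

  h₃′ : ∀ s j → let q = + 2 * s; μ = - (+ 1 + q); x = μ + + 2 * (- + 1 + + 8 * j) in
    x * (x * + 1 + (μ + + 1) - q * + 0) + (μ * (μ + + 1) - q * + 1) - q * + 1
      ≡ + 9 + + 16 * s + + 12 * (s * s) - + 96 * j - + 96 * s * j + + 256 * j * j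
  h₃′ = solve-∀

  h₃″ : ∀ s j r → + 9 + + 16 * s + + 12 * (s + + 2 * r) - + 96 * j - + 96 * s * j + + 256 * j * j
    ≡ + 1 + + 4 * s + + 8 * (+ 1 + + 3 * s + + 3 * r - + 12 * j - + 12 * s * j + + 32 * j * j)
  h₃″ = solve-∀

  h₃ : ∃ λ a → h q μ x 3 ≡ + 1 + + 4 * s + + 8 * a
  h₃ = _ , trans (h₃′ s j)
      (trans (cong (λ w → + 9 + + 16 * s + + 12 * w - + 96 * j - + 96 * s * j + + 256 * j * j) (proj₂ r))
             (h₃″ s j (proj₁ r)))

  h₄′ : ∀ s j b → let q = + 2 * s; μ = - (+ 1 + q); x = μ + + 2 * (- + 1 + + 8 * j) in
    x * (+ 1 + + 4 * s + + 8 * b) + (- q * (- q * (- q * + 1))) - q * (x * + 1 + (μ + + 1) - q * + 0)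
      ≡ + 5 + + 8 * (- + 1 - s + + 2 * j + + 4 * s * j + x * b - s * s * s)
  h₄′ = solve-∀

  h₄ : ∃ λ a → h q μ x 4 ≡ + 5 + + 8 * a
  h₄ = - + 1 - s + + 2 * j + + 4 * s * j + x * proj₁ h₃ - s * s * s ,
    trans (cong₂ (λ u v → x * u + v - q * h q μ x 2) (proj₂ h₃) (g[-d] q 3)) (h₄′ s j (proj₁ h₃))
h≡5mod8 s j (suc k) with h≡5mod8 s j k
... | (b , eq) , (a , eq′) = h₅ , h₆
  where
  m = k ℕ.* 2
  q = + 2 * s
  μ = - (+ 1 + q)
  x = μ + + 2 * (- + 1 + + 8 * j)

  h₅′ : ∀ s j a b P → let q = + 2 * s; x = - (+ 1 + q) + + 2 * (- + 1 + + 8 * j) in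
    x * (+ 5 + + 8 * a) + (- q * (- q * (- q * P))) - q * (+ 1 + + 4 * s + + 8 * b)
      ≡ + 1 + + 4 * s + + 8 * (- + 2 - + 2 * s + + 10 * j - s * s + x * a - s * s * s * P - + 2 * s * b)
  h₅′ = solve-∀

  h₅ : ∃ λ a → h q μ x (5 ℕ.+ m) ≡ + 1 + + 4 * s + + 8 * a
  h₅ = _ , trans (cong₃ (λ u v w → x * u + v - q * w) eq′ (g[-d] q (4 ℕ.+ m)) eq)
             (h₅′ s j a b ((- q) ^ (1 ℕ.+ m)))

  h₆′ : ∀ s j a b P → let q = + 2 * s; x = - (+ 1 + q) + + 2 * (- + 1 + + 8 * j) in
    x * (+ 1 + + 4 * s + + 8 * b) + (- q * (- q * (- q * P))) - q * (+ 5 + + 8 * a)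
      ≡ + 5 + + 8 * (- + 1 - + 3 * s + + 2 * j - s * s + + 8 * s * j + x * b - + 2 * s * a - s * s * s * P)
  h₆′ = solve-∀

  h₆ : ∃ λ a → h q μ x (6 ℕ.+ m) ≡ + 5 + + 8 * a
  h₆ = - + 1 - + 3 * s + + 2 * j - s * s + + 8 * s * j + x * proj₁ h₅ - + 2 * s * a - s * s * s * (- q) ^ (2 ℕ.+ m) ,
    trans (cong₃ (λ u v w → x * u + v - q * w) (proj₂ h₅) (g[-d] q (5 ℕ.+ m)) eq′)
             (h₆′ s j a (proj₁ h₅) ((- q) ^ (2 ℕ.+ m)))

64∣[-q]^m : ∀ s m → ∃ λ z → (- (+ 2 * s)) ^ (6 ℕ.+ m) ≡ + 64 * z
64∣[-q]^m s m = _ , lemma s ((- (+ 2 * s)) ^ m)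
  where
  lemma : ∀ s P → let q = + 2 * s in
    - q * (- q * (- q * (- q * (- q * (- q * P))))) ≡ + 64 * (s * s * s * (s * s * s) * P)
  lemma = solve-∀

-- (gx m, gy m) is G_m(M) applied to the column (e, f), and (hx μ m, hy μ m) is the divided difference
-- of G_m at M and μ applied to it, where M has the columns (a, b) and (b′, c).
module Planar (q a b b′ c e f : ℤ) where

  gx gy : ℕ → ℤ
  gx 0             = e
  gx 1             = a * e + b′ * f + e
  gx (suc (suc m)) = a * gx (suc m) + b′ * gy (suc m) - q * gx m
  gy 0             = f
  gy 1             = b * e + c * f + f
  gy (suc (suc m)) = b * gx (suc m) + c * gy (suc m) - q * gy m

  module _ (μ : ℤ) where

    hx hy : ℕ → ℤ
    hx 0             = + 0
    hx 1             = e
    hx (suc (suc m)) = a * hx (suc m) + b′ * hy (suc m) + g q μ (suc m) * e - q * hx m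
    hy 0             = + 0
    hy 1             = f
    hy (suc (suc m)) = b * hx (suc m) + c * hy (suc m) + g q μ (suc m) * f - q * hy m

    -- These are the two coordinates of (M - μ) H(μ, M) = G(M) - G(μ). The step moves M past M - μ
    -- (`lemma₁`), and since M mixes the coordinates the two proofs are mutually recursive.
    gx-difference : ∀ m → (a - μ) * hx m + b′ * hy m ≡ gx m - g q μ m * e
    gy-difference : ∀ m → b * hx m + (c - μ) * hy m ≡ gy m - g q μ m * f

    gx-difference 0 = lemma a b′ μ e
      where
      lemma : ∀ a b′ μ e → (a - μ) * + 0 + b′ * + 0 ≡ e - + 1 * e
      lemma = solve-∀
    gx-difference 1 = lemma a b′ μ e f
      where
      lemma : ∀ a b′ μ e f → (a - μ) * e + b′ * f ≡ a * e + b′ * f + e - (μ + + 1) * e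
      lemma = solve-∀
    gx-difference (suc (suc m)) = trans
      (lemma₁ a b b′ c q μ e f (hx (suc m)) (hy (suc m)) (hx m) (hy m) (g q μ (suc m)))
      (trans (cong₃ (λ u v w → a * u + b′ * v - q * w + g q μ (suc m) * ((a - μ) * e + b′ * f))
               (gx-difference (suc m)) (gy-difference (suc m)) (gx-difference m))
             (lemma₂ a b′ q μ e f (gx (suc m)) (gy (suc m)) (gx m) (g q μ (suc m)) (g q μ m)))
      where
      lemma₁ : ∀ a b b′ c q μ e f X Y X₀ Y₀ G →
        (a - μ) * (a * X + b′ * Y + G * e - q * X₀) + b′ * (b * X + c * Y + G * f - q * Y₀)
          ≡ a * ((a - μ) * X + b′ * Y) + b′ * (b * X + (c - μ) * Y) - q * ((a - μ) * X₀ + b′ * Y₀)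
              + G * ((a - μ) * e + b′ * f)
      lemma₁ = solve-∀

      lemma₂ : ∀ a b′ q μ e f U V U₀ G G₀ →
        a * (U - G * e) + b′ * (V - G * f) - q * (U₀ - G₀ * e) + G * ((a - μ) * e + b′ * f)
          ≡ a * U + b′ * V - q * U₀ - (μ * G - q * G₀) * e
      lemma₂ = solve-∀
    gy-difference 0 = lemma b c μ f
      where
      lemma : ∀ b c μ f → b * + 0 + (c - μ) * + 0 ≡ f - + 1 * f
      lemma = solve-∀
    gy-difference 1 = lemma b c μ e f
      where
      lemma : ∀ b c μ e f → b * e + (c - μ) * f ≡ b * e + c * f + f - (μ + + 1) * f
      lemma = solve-∀
    gy-difference (suc (suc m)) = trans
      (lemma₁ a b b′ c q μ e f (hx (suc m)) (hy (suc m)) (hx m) (hy m) (g q μ (suc m)))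
      (trans (cong₃ (λ u v w → b * u + c * v - q * w + g q μ (suc m) * (b * e + (c - μ) * f))
               (gx-difference (suc m)) (gy-difference (suc m)) (gy-difference m))
             (lemma₂ b c q μ e f (gx (suc m)) (gy (suc m)) (gy m) (g q μ (suc m)) (g q μ m)))
      where
      lemma₁ : ∀ a b b′ c q μ e f X Y X₀ Y₀ G →
        b * (a * X + b′ * Y + G * e - q * X₀) + (c - μ) * (b * X + c * Y + G * f - q * Y₀)
          ≡ b * ((a - μ) * X + b′ * Y) + c * (b * X + (c - μ) * Y) - q * (b * X₀ + (c - μ) * Y₀)
              + G * (b * e + (c - μ) * f)
      lemma₁ = solve-∀

      lemma₂ : ∀ b c q μ e f U V V₀ G G₀ →
        b * (U - G * e) + c * (V - G * f) - q * (V₀ - G₀ * f) + G * (b * e + (c - μ) * f)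
          ≡ b * U + c * V - q * V₀ - (μ * G - q * G₀) * f
      lemma₂ = solve-∀

module _ (s a₀ b₀ b₀′ c₀ e f : ℤ) where
  private
    q = + 2 * s
    μ = - (+ 1 + q)
  open Planar q (+ 1 + + 2 * a₀) (+ 2 * b₀) (+ 2 * b₀′) (+ 1 + + 2 * c₀) e f

  -- Modulo 2, M is the identity while q and G(-d), a positive power of -q, vanish. The recurrence
  -- therefore just repeats H₁ = I.
  h≡id-mod2 : ∀ m → (∃ λ k → hx μ (suc m) ≡ e + + 2 * k) × (∃ λ k → hy μ (suc m) ≡ f + + 2 * k)
  h≡id-mod2 0 = (+ 0 , sym (ℤₚ.+-identityʳ e)) , (+ 0 , sym (ℤₚ.+-identityʳ f))
  h≡id-mod2 (suc m) with h≡id-mod2 m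
  ... | (k , eq) , (l , eq′) =
    (k + a₀ * e + + 2 * a₀ * k + b₀′ * (f + + 2 * l) - s * P * e - s * hx μ m ,
     trans (cong₃ (λ u v w → (+ 1 + + 2 * a₀) * u + + 2 * b₀′ * v + w * e - q * hx μ m) eq eq′ (g[-d] q (suc m)))
           (lemma a₀ b₀′ s e f k l P (hx μ m))) ,
    (l + c₀ * f + + 2 * c₀ * l + b₀ * (e + + 2 * k) - s * P * f - s * hy μ m ,
     trans (cong₃ (λ u v w → + 2 * b₀ * u + (+ 1 + + 2 * c₀) * v + w * f - q * hy μ m) eq eq′ (g[-d] q (suc m)))
           -- Here the off-diagonal product comes first; swapping it lets the same `lemma` serve
           -- both coordinates.
           (trans (cong (λ u → u + _ - _) (ℤₚ.+-comm (+ 2 * b₀ * _) _)) (lemma c₀ b₀ s f e l k P (hy μ m))))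
    where
    P = (- q) ^ m
    lemma : ∀ a₀ b₀ s e f k l P H → let q = + 2 * s in
      (+ 1 + + 2 * a₀) * (e + + 2 * k) + + 2 * b₀ * (f + + 2 * l) + (- q * P) * e - q * H
        ≡ e + + 2 * (k + a₀ * e + + 2 * a₀ * k + b₀ * (f + + 2 * l) - s * P * e - s * H)
    lemma = solve-∀

-- Adjugate identities for 2×2 matrices whose product is scalar

module Cramer {a b b′ c X Y X′ Y′ r : ℤ}
              (eq₁ : a * X + b′ * Y ≡ r)   (eq₂ : b * X + c * Y ≡ + 0)
              (eq₃ : a * X′ + b′ * Y′ ≡ + 0) (eq₄ : b * X′ + c * Y′ ≡ r) where

  -- The hypotheses say M N = r I, where N has the columns (X, Y) and (X′, Y′). `K` is det N, and
  -- multiplying by the adjugate gives K M = r adj N, so the entries of M are reached without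
  -- division.
  K : ℤ
  K = X * Y′ - X′ * Y

  K*a : K * a ≡ r * Y′
  K*a = trans (lemma a b′ X X′ Y Y′) (trans (cong₂ (λ u v → Y′ * u - Y * v) eq₁ eq₃) (lemma₂ Y Y′ r))
    where
    lemma : ∀ a b′ X X′ Y Y′ → (X * Y′ - X′ * Y) * a ≡ Y′ * (a * X + b′ * Y) - Y * (a * X′ + b′ * Y′)
    lemma = solve-∀
    lemma₂ : ∀ Y Y′ r → Y′ * r - Y * + 0 ≡ r * Y′
    lemma₂ = solve-∀

  K*b′ : K * b′ ≡ r * - X′
  K*b′ = trans (lemma a b′ X X′ Y Y′) (trans (cong₂ (λ u v → X * u - X′ * v) eq₃ eq₁) (lemma₂ X X′ r))
    where
    lemma : ∀ a b′ X X′ Y Y′ → (X * Y′ - X′ * Y) * b′ ≡ X * (a * X′ + b′ * Y′) - X′ * (a * X + b′ * Y)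
    lemma = solve-∀
    lemma₂ : ∀ X X′ r → X * + 0 - X′ * r ≡ r * - X′
    lemma₂ = solve-∀

  K*b : K * b ≡ r * - Y
  K*b = trans (lemma b c X X′ Y Y′) (trans (cong₂ (λ u v → Y′ * u - Y * v) eq₂ eq₄) (lemma₂ Y Y′ r))
    where
    lemma : ∀ b c X X′ Y Y′ → (X * Y′ - X′ * Y) * b ≡ Y′ * (b * X + c * Y) - Y * (b * X′ + c * Y′)
    lemma = solve-∀
    lemma₂ : ∀ Y Y′ r → Y′ * + 0 - Y * r ≡ r * - Y
    lemma₂ = solve-∀

  K*c : K * c ≡ r * X
  K*c = trans (lemma b c X X′ Y Y′) (trans (cong₂ (λ u v → X * u - X′ * v) eq₄ eq₂) (lemma₂ X X′ r))
    where
    lemma : ∀ b c X X′ Y Y′ → (X * Y′ - X′ * Y) * c ≡ X * (b * X′ + c * Y′) - X′ * (b * X + c * Y)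
    lemma = solve-∀
    lemma₂ : ∀ X X′ r → X * r - X′ * + 0 ≡ r * X
    lemma₂ = solve-∀

  -- Multiplicativity of the determinant, applied to M N = r I.
  det*K : (a * c - b * b′) * K ≡ r * r
  det*K = trans (lemma a b b′ c X X′ Y Y′)
    (trans (cong₂ _-_ (cong₂ _*_ eq₁ eq₄) (cong₂ _*_ eq₃ eq₂)) (ℤₚ.+-identityʳ (r * r)))
    where
    lemma : ∀ a b b′ c X X′ Y Y′ → (a * c - b * b′) * (X * Y′ - X′ * Y)
      ≡ (a * X + b′ * Y) * (b * X′ + c * Y′) - (a * X′ + b′ * Y′) * (b * X + c * Y)
    lemma = solve-∀

-- Incompatibility of the conditions G(λ) = -2 and G(M) = 0

private
  -- The left side is divisible by 4 and -2 is not.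
  no-even : ∀ z u H → + 64 * z + + 2 * (+ 2 * u) * H ≢ - + 2
  no-even z u H eq = oddMultiple≢0 1 (+ 16 * z + u * H) (trans (lemma z u H) (i≡j⇒i-j≡0 eq))
    where
    lemma : ∀ z u H → + 2 * (+ 1 + + 2 * (+ 16 * z + u * H)) ≡ + 64 * z + + 2 * (+ 2 * u) * H - - + 2
    lemma = solve-∀

  -- Modulo 8 the left side is 2, whereas -2 is 6.
  no-1mod4 : ∀ z i j → + 64 * z + + 2 * (+ 1 + + 4 * j) * (+ 1 + + 4 * i) ≢ - + 2
  no-1mod4 z i j eq = oddMultiple≢0 3 (+ 8 * z + i + j + + 4 * i * j) (trans (lemma z i j) (i≡j⇒i-j≡0 eq))
    where
    lemma : ∀ z i j → + 4 * (+ 1 + + 2 * (+ 8 * z + i + j + + 4 * i * j))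
              ≡ + 64 * z + + 2 * (+ 1 + + 4 * j) * (+ 1 + + 4 * i) - - + 2
    lemma = solve-∀

  -- Modulo 16 the left side is -10 ≡ 6, whereas -2 is 14; the discrepancy is visible only at this
  -- precision.
  no-−1mod8 : ∀ z i j → + 64 * z + + 2 * (- + 1 + + 8 * j) * (+ 5 + + 8 * i) ≢ - + 2
  no-−1mod8 z i j eq = oddMultiple≢0 7 (+ 4 * z - + 1 - i + + 5 * j + + 8 * i * j)
    (trans (lemma z i j) (i≡j⇒i-j≡0 eq))
    where
    lemma : ∀ z i j → + 8 * (+ 1 + + 2 * (+ 4 * z - + 1 - i + + 5 * j + + 8 * i * j))
              ≡ + 64 * z + + 2 * (- + 1 + + 8 * j) * (+ 5 + + 8 * i) - - + 2
    lemma = solve-∀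

module _ (s : ℤ) (D : ℕ) where
  private
    q = + 2 * s
    μ = - (+ 1 + q)

  module _ (64∣ : ∃ λ z → (- q) ^ D ≡ + 64 * z) where

    g-expansion : ∀ t → g q (μ + + 2 * t) D ≡ - + 2 →
                  + 64 * proj₁ 64∣ + + 2 * t * h[-d] s t D ≡ - + 2
    g-expansion t eq =
      trans (cong₂ (λ u v → u + v * h q μ (μ + + 2 * t) D) (sym (trans (g[-d] q D) (proj₂ 64∣))) (lemma μ t))
            (trans (sym (g-difference q μ (μ + + 2 * t) D)) eq)
      where
      lemma : ∀ μ t → + 2 * t ≡ μ + + 2 * t - μ
      lemma = solve-∀

    t-odd : ∀ t → g q (μ + + 2 * t) D ≡ - + 2 → ∃ λ u → t ≡ + 1 + + 2 * u
    t-odd t eq with parity t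
    ... | inj₂ odd = odd
    ... | inj₁ (u , refl) =
      ⊥-elim (no-even (proj₁ 64∣) u (h[-d] s (+ 2 * u) D) (g-expansion (+ 2 * u) eq))

    t≢1mod4 : ∀ j → (∃ λ i → h[-d] s (+ 1 + + 4 * j) D ≡ + 1 + + 4 * i) →
              g q (μ + + 2 * (+ 1 + + 4 * j)) D ≢ - + 2
    t≢1mod4 j (i , eqₕ) eq = no-1mod4 (proj₁ 64∣) i j
      (trans (cong (λ w → + 64 * proj₁ 64∣ + + 2 * (+ 1 + + 4 * j) * w) (sym eqₕ))
             (g-expansion (+ 1 + + 4 * j) eq))

    t≢−1mod8 : ∀ j → (∃ λ i → h[-d] s (- + 1 + + 8 * j) D ≡ + 5 + + 8 * i) →
               g q (μ + + 2 * (- + 1 + + 8 * j)) D ≢ - + 2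
    t≢−1mod8 j (i , eqₕ) eq = no-−1mod8 (proj₁ 64∣) i j
      (trans (cong (λ w → + 64 * proj₁ 64∣ + + 2 * (- + 1 + + 8 * j) * w) (sym eqₕ))
             (g-expansion (- + 1 + + 8 * j) eq))

module _ (q a b b′ c ν G : ℤ) (D : ℕ)
         (gν≡G : g q ν D ≡ G)
         (gx₀ : Planar.gx q a b b′ c (+ 1) (+ 0) D ≡ + 0) (gy₀ : Planar.gy q a b b′ c (+ 1) (+ 0) D ≡ + 0)
         (gx₁ : Planar.gx q a b b′ c (+ 0) (+ 1) D ≡ + 0) (gy₁ : Planar.gy q a b b′ c (+ 0) (+ 1) D ≡ + 0)
         where
  private
    module P₀ = Planar q a b b′ c (+ 1) (+ 0)
    module P₁ = Planar q a b b′ c (+ 0) (+ 1)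

    diag : ∀ G → + 0 - G * + 1 ≡ - G
    diag = solve-∀

    off : ∀ G → + 0 - G * + 0 ≡ + 0
    off = solve-∀

  -- Since G(M) = 0, the product (M - ν) H(ν, M) is the scalar -G(ν). This is used at ν = -d, where
  -- the scalar is a multiple of 64, and at ν = λ, where it is 2.
  module Resolvent = Cramer {a - ν} {b} {b′} {c - ν} {P₀.hx ν D} {P₀.hy ν D} {P₁.hx ν D} {P₁.hy ν D} { - G}
    (trans (P₀.gx-difference ν D) (trans (cong₂ (λ u v → u - v * + 1) gx₀ gν≡G) (diag G)))
    (trans (P₀.gy-difference ν D) (trans (cong₂ (λ u v → u - v * + 0) gy₀ gν≡G) (off G)))
    (trans (P₁.gx-difference ν D) (trans (cong₂ (λ u v → u - v * + 0) gx₁ gν≡G) (off G)))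
    (trans (P₁.gy-difference ν D) (trans (cong₂ (λ u v → u - v * + 1) gy₁ gν≡G) (diag G)))

64∣entry : ∀ K x z y κ → K ≡ + 1 + + 2 * κ → K * x ≡ - (+ 64 * z) * y → ∃ λ w → x ≡ + 64 * w
64∣entry _ x z y κ refl eq = cancelOdd₆₄ x (- z * y) κ (trans eq (lemma z y))
  where
  lemma : ∀ z y → - (+ 64 * z) * y ≡ + 64 * (- z * y)
  lemma = solve-∀

-- With M = μ + 64 N one has M - ν = 64 N - 2t. Every term of its determinant other than 4t² is
-- divisible by 64, so dividing by 4 leaves t² + 16w, a divisor of 1.
det-unit : ∀ μ t a b b′ c K → let ν = μ + + 2 * t in
  (∃ λ α → a - μ ≡ + 64 * α) → (∃ λ β → b ≡ + 64 * β) →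
  (∃ λ β → b′ ≡ + 64 * β) → (∃ λ γ → c - μ ≡ + 64 * γ) →
  ((a - ν) * (c - ν) - b * b′) * K ≡ + 4 →
  ∃ λ w → t * t + + 16 * w ≡ + 1 ⊎ t * t + + 16 * w ≡ - + 1
det-unit μ t a b b′ c K (α , eqα) (β , refl) (β′ , refl) (γ , eqγ) eq =
  w , unit (t * t + + 16 * w) K (ℤₚ.*-cancelˡ-≡ (+ 4) _ _
    (trans (lemma t α β β′ γ K)
      (trans (cong₂ (λ u v → ((u - + 2 * t) * (v - + 2 * t) - + 64 * β * (+ 64 * β′)) * K)
                    (sym eqα) (sym eqγ))
        (trans (shift μ t a c (+ 64 * β) (+ 64 * β′) K) eq))))
  where
  w = + 64 * α * γ - + 2 * t * (α + γ) - + 64 * β * β′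

  lemma : ∀ t α β β′ γ K →
    + 4 * ((t * t + + 16 * (+ 64 * α * γ - + 2 * t * (α + γ) - + 64 * β * β′)) * K)
      ≡ ((+ 64 * α - + 2 * t) * (+ 64 * γ - + 2 * t) - + 64 * β * (+ 64 * β′)) * K
  lemma = solve-∀

  shift : ∀ μ t a c B B′ K →
    ((a - μ - + 2 * t) * (c - μ - + 2 * t) - B * B′) * K
      ≡ ((a - (μ + + 2 * t)) * (c - (μ + + 2 * t)) - B * B′) * K
  shift = solve-∀

-- A matrix ≡ I (mod 2) has odd determinant. The summands `+ 0` match what `h≡id-mod2` returns on
-- the two basis columns.
odd-det : ∀ X Y X′ Y′ → (∃ λ k → X ≡ + 1 + + 2 * k) → (∃ λ k → Y ≡ + 0 + + 2 * k) →
          (∃ λ k → X′ ≡ + 0 + + 2 * k) → (∃ λ k → Y′ ≡ + 1 + + 2 * k) →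
          ∃ λ κ → X * Y′ - X′ * Y ≡ + 1 + + 2 * κ
odd-det _ _ _ _ (i , refl) (j , refl) (k , refl) (l , refl) =
  i + l + + 2 * i * l - + 2 * k * j , lemma i j k l
  where
  lemma : ∀ i j k l → (+ 1 + + 2 * i) * (+ 1 + + 2 * l) - (+ 0 + + 2 * k) * (+ 0 + + 2 * j)
            ≡ + 1 + + 2 * (i + l + + 2 * i * l - + 2 * k * j)
  lemma = solve-∀

module _ (s : ℤ) (m : ℕ) where
  private
    q = + 2 * s
    μ = - (+ 1 + q)
    D = suc m

  module _ (64∣ : ∃ λ z → (- q) ^ D ≡ + 64 * z)
           (h≡1 : ∀ j → ∃ λ i → h[-d] s (+ 1 + + 4 * j) D ≡ + 1 + + 4 * i)
           (h≡5 : ∀ j → ∃ λ i → h[-d] s (- + 1 + + 8 * j) D ≡ + 5 + + 8 * i)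
           where

    no-odd-spectrum : ∀ t u a₀ b₀ b₀′ c₀ →
      let a = + 1 + + 2 * a₀; b = + 2 * b₀; b′ = + 2 * b₀′; c = + 1 + + 2 * c₀ in
      t ≡ + 1 + + 2 * u → g q (μ + + 2 * t) D ≡ - + 2 →
      Planar.gx q a b b′ c (+ 1) (+ 0) D ≡ + 0 → Planar.gy q a b b′ c (+ 1) (+ 0) D ≡ + 0 →
      Planar.gx q a b b′ c (+ 0) (+ 1) D ≡ + 0 → Planar.gy q a b b′ c (+ 0) (+ 1) D ≡ + 0 → ⊥
    no-odd-spectrum t u a₀ b₀ b₀′ c₀ refl gλ gx₀ gy₀ gx₁ gy₁ = conclude (oddSquareNearUnit u (proj₁ near) (proj₂ near)) gλ
      where
      a  = + 1 + + 2 * a₀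
      b  = + 2 * b₀
      b′ = + 2 * b₀′
      c  = + 1 + + 2 * c₀
      z  = proj₁ 64∣
      module P₀ = Planar q a b b′ c (+ 1) (+ 0)
      module P₁ = Planar q a b b′ c (+ 0) (+ 1)
      -- At ν = -d: the odd determinant `R.K` can be cancelled modulo 64, whence every entry of M +
      -- d is a multiple of 64.
      module R = Resolvent q a b b′ c μ (+ 64 * z) D (trans (g[-d] q D) (proj₂ 64∣)) gx₀ gy₀ gx₁ gy₁
      -- At ν = λ: the scalar is 2, so `S.det*K` makes det(M - λ) a divisor of 4.
      module S = Resolvent q a b b′ c (μ + + 2 * t) (- + 2) D gλ gx₀ gy₀ gx₁ gy₁

      h₀ = h≡id-mod2 s a₀ b₀ b₀′ c₀ (+ 1) (+ 0) m
      h₁ = h≡id-mod2 s a₀ b₀ b₀′ c₀ (+ 0) (+ 1) m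

      K-odd : ∃ λ κ → R.K ≡ + 1 + + 2 * κ
      K-odd = odd-det (P₀.hx μ D) (P₀.hy μ D) (P₁.hx μ D) (P₁.hy μ D) (proj₁ h₀) (proj₂ h₀) (proj₁ h₁) (proj₂ h₁)

      entry : ∀ x y → R.K * x ≡ - (+ 64 * z) * y → ∃ λ w → x ≡ + 64 * w
      entry x y = 64∣entry R.K x z y (proj₁ K-odd) (proj₂ K-odd)

      near : ∃ λ w → t * t + + 16 * w ≡ + 1 ⊎ t * t + + 16 * w ≡ - + 1
      near = det-unit μ t a b b′ c S.K
        (entry (a - μ) (P₁.hy μ D) R.K*a) (entry b (- P₀.hy μ D) R.K*b)
        (entry b′ (- P₁.hx μ D) R.K*b′) (entry (c - μ) (P₀.hx μ D) R.K*c) S.det*K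

      -- The number t is generalised so that matching on `refl` can replace it by the residue form.
      conclude : ∀ {t} → (∃ λ j → t ≡ + 1 + + 4 * j) ⊎ (∃ λ j → t ≡ - + 1 + + 8 * j) → g q (μ + + 2 * t) D ≢ - + 2
      conclude (inj₁ (j , refl)) = t≢1mod4 s D 64∣ j (h≡1 j)
      conclude (inj₂ (j , refl)) = t≢−1mod8 s D 64∣ j (h≡5 j)

    -- Once t is known to be odd, 1 + q - t is even, and the four congruences become M ≡ I (mod 2).
    no-spectrum : ∀ t a b b′ c →
      (∃ λ k → a ≡ t + + 2 * k) → (∃ λ k → b ≡ + 1 + q - t + + 2 * k) →
      (∃ λ k → b′ ≡ + 1 + q - t + + 2 * k) → (∃ λ k → c ≡ t + + 2 * k) →
      g q (μ + + 2 * t) D ≡ - + 2 →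
      Planar.gx q a b b′ c (+ 1) (+ 0) D ≡ + 0 → Planar.gy q a b b′ c (+ 1) (+ 0) D ≡ + 0 →
      Planar.gx q a b b′ c (+ 0) (+ 1) D ≡ + 0 → Planar.gy q a b b′ c (+ 0) (+ 1) D ≡ + 0 → ⊥
    no-spectrum t a b b′ c (i , eqa) (j , eqb) (k , eqb′) (l , eqc) gλ gx₀ gy₀ gx₁ gy₁ =
      go (odd i a eqa) (even j b eqb) (even k b′ eqb′) (odd l c eqc) gx₀ gy₀ gx₁ gy₁
      where
      u   = proj₁ (t-odd s D 64∣ t gλ)
      t≡ = proj₂ (t-odd s D 64∣ t gλ)

      odd : ∀ i a → a ≡ t + + 2 * i → a ≡ + 1 + + 2 * (u + i)
      odd i a eq = trans eq (trans (cong (λ w → w + + 2 * i) t≡) (lemma u i))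
        where
        lemma : ∀ u i → + 1 + + 2 * u + + 2 * i ≡ + 1 + + 2 * (u + i)
        lemma = solve-∀

      even : ∀ i b → b ≡ + 1 + q - t + + 2 * i → b ≡ + 2 * (s - u + i)
      even i b eq = trans eq (trans (cong (λ w → + 1 + q - w + + 2 * i) t≡) (lemma s u i))
        where
        lemma : ∀ s u i → + 1 + + 2 * s - (+ 1 + + 2 * u) + + 2 * i ≡ + 2 * (s - u + i)
        lemma = solve-∀

      go : ∀ {a b b′ c} → a ≡ + 1 + + 2 * (u + i) → b ≡ + 2 * (s - u + j) →
           b′ ≡ + 2 * (s - u + k) → c ≡ + 1 + + 2 * (u + l) →
           Planar.gx q a b b′ c (+ 1) (+ 0) D ≡ + 0 → Planar.gy q a b b′ c (+ 1) (+ 0) D ≡ + 0 →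
           Planar.gx q a b b′ c (+ 0) (+ 1) D ≡ + 0 → Planar.gy q a b b′ c (+ 0) (+ 1) D ≡ + 0 → ⊥
      go refl refl refl refl = no-odd-spectrum t u (u + i) (s - u + j) (s - u + k) (u + l) t≡ gλ

-- Matrices acting on integer vectors

sum-cong : ∀ {n} {f g : Fin n → ℤ} → f ≗ g → sumℤ f ≡ sumℤ g
sum-cong {zero}  f≗g = refl
sum-cong {suc n} f≗g = cong₂ _+_ (f≗g zero) (sum-cong (f≗g ∘ suc))

sum-zero : ∀ {n} {f : Fin n → ℤ} → (∀ i → f i ≡ + 0) → sumℤ f ≡ + 0
sum-zero {zero}  f≗0 = refl
sum-zero {suc n} f≗0 = cong₂ _+_ (f≗0 zero) (sum-zero (f≗0 ∘ suc))

sum-linear : ∀ {n} a b (f g : Fin n → ℤ) →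
             sumℤ (λ i → a * f i + b * g i) ≡ a * sumℤ f + b * sumℤ g
sum-linear {zero}  a b f g = sym (cong₂ _+_ (ℤₚ.*-zeroʳ a) (ℤₚ.*-zeroʳ b))
sum-linear {suc n} a b f g = trans
  (cong (λ w → a * f zero + b * g zero + w) (sum-linear a b (f ∘ suc) (g ∘ suc)))
  (lemma a b (f zero) (g zero) (sumℤ (f ∘ suc)) (sumℤ (g ∘ suc)))
  where
  lemma : ∀ a b x y X Y → a * x + b * y + (a * X + b * Y) ≡ a * (x + X) + b * (y + Y)
  lemma = solve-∀

sum-+ : ∀ {n} (f g : Fin n → ℤ) → sumℤ (λ i → f i + g i) ≡ sumℤ f + sumℤ g
sum-+ {zero}  f g = refl
sum-+ {suc n} f g = trans (cong (λ w → f zero + g zero + w) (sum-+ (f ∘ suc) (g ∘ suc)))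
                          (lemma (f zero) (g zero) (sumℤ (f ∘ suc)) (sumℤ (g ∘ suc)))
  where
  lemma : ∀ x y X Y → x + y + (X + Y) ≡ x + X + (y + Y)
  lemma = solve-∀

sum-*ˡ : ∀ {n} c (f : Fin n → ℤ) → sumℤ (λ i → c * f i) ≡ c * sumℤ f
sum-*ˡ {zero}  c f = sym (ℤₚ.*-zeroʳ c)
sum-*ˡ {suc n} c f = trans (cong (λ w → c * f zero + w) (sum-*ˡ c (f ∘ suc)))
                           (sym (ℤₚ.*-distribˡ-+ c (f zero) (sumℤ (f ∘ suc))))

sum-swap : ∀ {m n} (f : Fin m → Fin n → ℤ) →
           sumℤ (λ i → sumℤ (f i)) ≡ sumℤ (λ j → sumℤ (λ i → f i j))
sum-swap {zero} {n} f = sym (sum-zero {n} λ _ → refl)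
sum-swap {suc m}     f = trans (cong (λ w → sumℤ (f zero) + w) (sum-swap (f ∘ suc)))
                           (sym (sum-+ (f zero) (λ j → sumℤ (λ i → f (suc i) j))))

sum-single : ∀ {n} (f : Fin n → ℤ) i → (∀ k → k ≢ i → f k ≡ + 0) → sumℤ f ≡ f i
sum-single f zero    f≗0 = trans (cong (λ w → f zero + w) (sum-zero λ k → f≗0 (suc k) λ ()))
                                 (ℤₚ.+-identityʳ (f zero))
sum-single f (suc i) f≗0 = trans
  (cong₂ _+_ (f≗0 zero λ ()) (sum-single (f ∘ suc) i λ k k≢i → f≗0 (suc k) λ { refl → k≢i refl }))
  (ℤₚ.+-identityˡ (f (suc i)))

sum-const : ∀ n c → sumℤ {n} (λ _ → c) ≡ + n * c
sum-const zero    c = refl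
sum-const (suc n) c = trans (cong (λ w → c + w) (sum-const n c)) (sym (ℤₚ.suc-* (+ n) c))

sum-b2 : ∀ {n} (f : Fin n → _) → sumℤ (λ i → b2ℤ (f i)) ≡ + sumℕ (λ i → b2ℕ (f i))
sum-b2 {zero}  f = refl
sum-b2 {suc n} f = cong₂ _+_ (b2 (f zero)) (sum-b2 (f ∘ suc))
  where
  b2 : ∀ b → b2ℤ b ≡ + b2ℕ b
  b2 true  = refl
  b2 false = refl

idM-diag : ∀ {n} (i : Fin n) → idM i i ≡ + 1
idM-diag i with toℕ i ℕ.≟ toℕ i
... | yes _   = refl
... | no i≢i = contradiction refl i≢i

idM-off : ∀ {n} {i j : Fin n} → j ≢ i → idM i j ≡ + 0
idM-off {i = i} {j} j≢i with toℕ i ℕ.≟ toℕ j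
... | yes i≡j = contradiction (sym (toℕ-injective i≡j)) j≢i
... | no _    = refl

act : ∀ {n} → Mat n → (Fin n → ℤ) → Fin n → ℤ
act M u i = sumℤ λ k → M i k * u k

act-cong : ∀ {n} {M N : Mat n} {u v} → (∀ i j → M i j ≡ N i j) → u ≗ v → act M u ≗ act N v
act-cong M≗N u≗v i = sum-cong λ k → cong₂ _*_ (M≗N i k) (u≗v k)

act-congʳ : ∀ {n} (M : Mat n) {u v} → u ≗ v → act M u ≗ act M v
act-congʳ M = act-cong {M = M} λ _ _ → refl

act-linear : ∀ {n} (M : Mat n) a b u v i →
             act M (λ k → a * u k + b * v k) i ≡ a * act M u i + b * act M v i
act-linear M a b u v i = trans (sum-cong λ k → lemma (M i k) a b (u k) (v k))
                               (sum-linear a b (λ k → M i k * u k) (λ k → M i k * v k))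
  where
  lemma : ∀ m a b x y → m * (a * x + b * y) ≡ a * (m * x) + b * (m * y)
  lemma = solve-∀

act-scale : ∀ {n} (M : Mat n) c u i → act M (λ k → c * u k) i ≡ c * act M u i
act-scale M c u i = trans (sum-cong λ k → lemma (M i k) c (u k)) (sum-*ˡ c (λ k → M i k * u k))
  where
  lemma : ∀ m c x → m * (c * x) ≡ c * (m * x)
  lemma = solve-∀

act-const : ∀ {n} (M : Mat n) c i → act M (λ _ → c) i ≡ c * act M (λ _ → + 1) i
act-const M c i = trans (act-congʳ M (λ _ → sym (ℤₚ.*-identityʳ c)) i) (act-scale M c (λ _ → + 1) i)

act-⊛ : ∀ {n} (M N : Mat n) u i → act (M ⊛ N) u i ≡ act M (act N u) i
act-⊛ M N u i = begin
  sumℤ (λ k → sumℤ (λ l → M i l * N l k) * u k)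
    ≡⟨ sum-cong (λ k → trans (ℤₚ.*-comm _ (u k)) (sym (sum-*ˡ (u k) (λ l → M i l * N l k)))) ⟩
  sumℤ (λ k → sumℤ (λ l → u k * (M i l * N l k)))  ≡⟨ sum-swap (λ k l → u k * (M i l * N l k)) ⟩
  sumℤ (λ l → sumℤ (λ k → u k * (M i l * N l k)))
    ≡⟨ sum-cong (λ l → trans (sum-cong λ k → lemma (u k) (M i l) (N l k)) (sum-*ˡ (M i l) (λ k → N l k * u k))) ⟩
  sumℤ (λ l → M i l * sumℤ (λ k → N l k * u k))    ∎
  where
  open ≡-Reasoning
  lemma : ∀ x y z → x * (y * z) ≡ y * (z * x)
  lemma = solve-∀

act-⊕ : ∀ {n} (M N : Mat n) u i → act (M ⊕ N) u i ≡ act M u i + act N u i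
act-⊕ M N u i = trans (sum-cong λ k → ℤₚ.*-distribʳ-+ (u k) (M i k) (N i k))
                      (sum-+ (λ k → M i k * u k) (λ k → N i k * u k))

act-⊝-scale : ∀ {n} (M N : Mat n) c u i → act (M ⊝ scale c N) u i ≡ act M u i - c * act N u i
act-⊝-scale M N c u i = trans (sum-cong λ k → lemma (M i k) (N i k) c (u k))
  (trans (sum-+ (λ k → M i k * u k) (λ k → - c * (N i k * u k)))
    (cong (λ w → act M u i + w) (trans (sum-*ˡ (- c) (λ k → N i k * u k)) (sym (ℤₚ.neg-distribˡ-* c _)))))
  where
  lemma : ∀ m n c x → (m - c * n) * x ≡ m * x + - c * (n * x)
  lemma = solve-∀

act-idM : ∀ {n} (u : Fin n → ℤ) i → act idM u i ≡ u i
act-idM u i = trans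
  (sum-single (λ k → idM i k * u k) i λ k k≢i → cong (_* u k) (idM-off k≢i))
  (trans (cong (_* u i) (idM-diag i)) (ℤₚ.*-identityˡ (u i)))

act-onesM : ∀ {n} (u : Fin n → ℤ) i → act onesM u i ≡ sumℤ u
act-onesM u i = sum-cong λ k → ℤₚ.*-identityˡ (u k)

-- By symmetry the column sums are also r; exchanging the two summations collects them.
sum-act : ∀ {n} (M : Mat n) r → (∀ i j → M i j ≡ M j i) → (∀ i → act M (λ _ → + 1) i ≡ r) →
          ∀ u → sumℤ (act M u) ≡ r * sumℤ u
sum-act M r M-sym row u = begin
  sumℤ (λ i → sumℤ (λ k → M i k * u k))        ≡⟨ sum-swap (λ i k → M i k * u k) ⟩
  sumℤ (λ k → sumℤ (λ i → M i k * u k))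
    ≡⟨ sum-cong (λ k → sum-cong λ i → trans (cong (_* u k) (M-sym i k)) (lemma (M k i) (u k))) ⟩
  sumℤ (λ k → sumℤ (λ i → u k * (M k i * + 1)))
    ≡⟨ sum-cong (λ k → trans (sum-*ˡ (u k) (λ i → M k i * + 1)) (trans (cong (u k *_) (row k)) (ℤₚ.*-comm (u k) r))) ⟩
  sumℤ (λ k → r * u k)                         ≡⟨ sum-*ˡ r u ⟩
  r * sumℤ u                                   ∎
  where
  open ≡-Reasoning
  lemma : ∀ m x → m * x ≡ x * (m * + 1)
  lemma = solve-∀

-- An abstract `q` allows the recurrence to run with 2s in place of the truncated difference
-- `d ℕ.∸ 1`.
module _ {n} (A : Mat n) (d : ℕ) {q : ℤ} (q≡ : + (d ℕ.∸ 1) ≡ q) where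
  private
    G : ℕ → (Fin n → ℤ) → Fin n → ℤ
    G m = act (GMat d m A)

  act-GMat-1 : ∀ u i → G 1 u i ≡ act A u i + u i
  act-GMat-1 u i = trans (act-⊕ A idM u i) (cong (λ w → act A u i + w) (act-idM u i))

  act-GMat-suc : ∀ m u i → G (suc (suc m)) u i ≡ act A (G (suc m) u) i - q * G m u i
  act-GMat-suc m u i = trans (act-⊝-scale (A ⊛ GMat d (suc m) A) (GMat d m A) (+ (d ℕ.∸ 1)) u i)
                             (cong₂ (λ x y → x - y * G m u i) (act-⊛ A (GMat d (suc m) A) u i) q≡)

  act-A-combine : ∀ u v i → act A (λ k → act A u k - q * v k) i ≡ act A (act A u) i - q * act A v i
  act-A-combine u v i = trans (act-congʳ A (λ k → lemma (act A u k) q (v k)) i)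
    (trans (act-linear A (+ 1) (- q) (act A u) v i) (sym (lemma (act A (act A u) i) q (act A v i))))
    where
    lemma : ∀ x q y → x - q * y ≡ + 1 * x + - q * y
    lemma = solve-∀

  -- `GMat d m A` is a polynomial in A, so the induction follows its recurrence. This is what later
  -- makes A commute with J + B.
  GMat-commutes : ∀ m u → act A (G m u) ≗ G m (act A u)
  GMat-commutes 0 u i = trans (act-congʳ A (act-idM u) i) (sym (act-idM (act A u) i))
  GMat-commutes 1 u i = trans (act-congʳ A (λ k → trans (act-GMat-1 u k) (lemma (act A u k) (u k))) i)
    (trans (act-linear A (+ 1) (+ 1) (act A u) u i)
      (trans (sym (lemma (act A (act A u) i) (act A u i))) (sym (act-GMat-1 (act A u) i))))
    where
    lemma : ∀ x y → x + y ≡ + 1 * x + + 1 * y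
    lemma = solve-∀
  GMat-commutes (suc (suc m)) u i = begin
    act A (G (suc (suc m)) u) i                                ≡⟨ act-congʳ A (act-GMat-suc m u) i ⟩
    act A (λ k → act A (G (suc m) u) k - q * G m u k) i        ≡⟨ act-A-combine (G (suc m) u) (G m u) i ⟩
    act A (act A (G (suc m) u)) i - q * act A (G m u) i
      ≡⟨ cong₂ (λ x y → x - q * y) (act-congʳ A (GMat-commutes (suc m) u) i) (GMat-commutes m u i) ⟩
    act A (G (suc m) (act A u)) i - q * G m (act A u) i        ≡⟨ act-GMat-suc m (act A u) i ⟨
    G (suc (suc m)) (act A u) i                                ∎
    where open ≡-Reasoning

  GMat-eigen : ∀ {μ u} → (∀ i → act A u i ≡ μ * u i) → ∀ m i → G m u i ≡ g q μ m * u i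
  GMat-eigen {μ} {u} eig 0 i = trans (act-idM u i) (sym (ℤₚ.*-identityˡ (u i)))
  GMat-eigen {μ} {u} eig 1 i = trans (act-GMat-1 u i) (trans (cong (_+ u i) (eig i)) (lemma μ (u i)))
    where
    lemma : ∀ μ x → μ * x + x ≡ (μ + + 1) * x
    lemma = solve-∀
  GMat-eigen {μ} {u} eig (suc (suc m)) i = begin
    G (suc (suc m)) u i                              ≡⟨ act-GMat-suc m u i ⟩
    act A (G (suc m) u) i - q * G m u i
      ≡⟨ cong₂ (λ x y → x - q * y) (act-congʳ A (GMat-eigen eig (suc m)) i) (GMat-eigen eig m i) ⟩
    act A (λ k → g₁ * u k) i - q * (g₀ * u i)
      ≡⟨ cong (_- q * (g₀ * u i)) (trans (act-scale A g₁ u i) (cong (g₁ *_) (eig i))) ⟩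
    g₁ * (μ * u i) - q * (g₀ * u i)                  ≡⟨ lemma g₁ g₀ q μ (u i) ⟩
    (μ * g₁ - q * g₀) * u i                          ∎
    where
    open ≡-Reasoning
    g₁ = g q μ (suc m)
    g₀ = g q μ m
    lemma : ∀ g₁ g₀ q μ x → g₁ * (μ * x) - q * (g₀ * x) ≡ (μ * g₁ - q * g₀) * x
    lemma = solve-∀

  module _ {v w : Fin n → ℤ} {a b b′ c : ℤ}
           (Av : ∀ i → act A v i ≡ a * v i + b * w i)
           (Aw : ∀ i → act A w i ≡ b′ * v i + c * w i)
           (e f : ℤ) where

    open Planar q a b b′ c e f

    private
      act-plane : ∀ x y i → act A (λ k → x * v k + y * w k) i ≡ (a * x + b′ * y) * v i + (b * x + c * y) * w i
      act-plane x y i = trans (act-linear A x y v w i)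
        (trans (cong₂ (λ s t → x * s + y * t) (Av i) (Aw i)) (lemma x y a b b′ c (v i) (w i)))
        where
        lemma : ∀ x y a b b′ c v w → x * (a * v + b * w) + y * (b′ * v + c * w)
                                       ≡ (a * x + b′ * y) * v + (b * x + c * y) * w
        lemma = solve-∀

    GMat-plane : ∀ {u} → (∀ i → u i ≡ e * v i + f * w i) → ∀ m i → G m u i ≡ gx m * v i + gy m * w i
    GMat-plane {u} u≗ 0 i = trans (act-idM u i) (u≗ i)
    GMat-plane {u} u≗ 1 i = trans (act-GMat-1 u i)
      (trans (cong₂ _+_ (trans (act-congʳ A u≗ i) (act-plane e f i)) (u≗ i))
             (lemma (a * e + b′ * f) (b * e + c * f) e f (v i) (w i)))
      where
      lemma : ∀ x y e f v w → x * v + y * w + (e * v + f * w) ≡ (x + e) * v + (y + f) * w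
      lemma = solve-∀
    GMat-plane {u} u≗ (suc (suc m)) i = trans (act-GMat-suc m u i)
      (trans (cong₂ (λ s t → s - q * t)
               (trans (act-congʳ A (GMat-plane u≗ (suc m)) i) (act-plane (gx (suc m)) (gy (suc m)) i))
               (GMat-plane u≗ m i))
             (lemma (a * gx (suc m) + b′ * gy (suc m)) (b * gx (suc m) + c * gy (suc m)) q (gx m) (gy m) (v i) (w i)))
      where
      lemma : ∀ x y q e f v w → x * v + y * w - q * (e * v + f * w) ≡ (x - q * e) * v + (y - q * f) * w
      lemma = solve-∀

-- The action of a cycle matrix

-- A view of `cycAdj` indexed by its value: a case split reveals the direction of the adjacency and
-- fixes the boolean at once.
data CycSpec {m} (i j : Fin (suc m)) : Bool → Set where
  succ : suc (toℕ i) % suc m ≡ toℕ j → CycSpec i j true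
  pred : suc (toℕ j) % suc m ≡ toℕ i → CycSpec i j true
  none : suc (toℕ i) % suc m ≢ toℕ j → suc (toℕ j) % suc m ≢ toℕ i → CycSpec i j false

cycAdj-spec : ∀ {m} (i j : Fin (suc m)) → CycSpec i j (cycAdj i j)
cycAdj-spec {m} i j with suc (toℕ i) % suc m ℕ.≟ toℕ j | suc (toℕ j) % suc m ℕ.≟ toℕ i
... | yes p | _     = succ p
... | no _  | yes p = pred p
... | no p  | no p′ = none p p′

cycAdj-sym : ∀ {m} (i j : Fin (suc m)) → cycAdj i j ≡ cycAdj j i
cycAdj-sym i j with cycAdj i j | cycAdj-spec i j | cycAdj j i | cycAdj-spec j i
... | _ | succ _   | _ | succ _   = refl
... | _ | succ _   | _ | pred _   = refl
... | _ | pred _   | _ | succ _   = refl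
... | _ | pred _   | _ | pred _   = refl
... | _ | none _ _ | _ | none _ _ = refl
... | _ | succ p   | _ | none _ r = contradiction p r
... | _ | pred p   | _ | none r _ = contradiction p r
... | _ | none _ r | _ | succ p   = contradiction p r
... | _ | none r _ | _ | pred p   = contradiction p r

module _ (m : ℕ) where
  private
    n = suc m

  suc-%-cong : ∀ i → suc (i % n) % n ≡ suc i % n
  suc-%-cong i = trans (%-distribˡ-+ 1 (i % n) n)
    (trans (cong (λ w → (1 % n ℕ.+ w) % n) (m%n%n≡m%n i n)) (sym (%-distribˡ-+ 1 i n)))

  -- Adding `m`, which is -1 modulo n, undoes the successor.
  suc-%-cancel : ∀ i j → suc i % n ≡ suc j % n → i % n ≡ j % n
  suc-%-cancel i j eq = trans (sym (shift i)) (trans (cong (λ w → (w ℕ.+ m % n) % n) eq) (shift j))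
    where
    shift : ∀ i → (suc i % n ℕ.+ m % n) % n ≡ i % n
    shift i = trans (sym (%-distribˡ-+ (suc i) m n))
      (trans (cong (_% n) (sym (ℕₚ.+-suc i m))) ([m+n]%n≡m%n i n))

  -- The two cycle neighbours of a vertex differ because n ≥ 3; cancelling successors reduces this
  -- to 2 ≢ 0 modulo n.
  2+i≢i : 2 ≤ m → ∀ i → suc (suc i) % n ≢ i % n
  2+i≢i (s≤s (s≤s _)) zero ()
  2+i≢i 2≤m (suc i) eq = 2+i≢i 2≤m i (suc-%-cancel (suc (suc i)) i eq)

  periodic-% : ∀ {ℓ} {X : Set ℓ} (f : ℕ → X) → (∀ i → f (i ℕ.+ n) ≡ f i) → ∀ i → f (i % n) ≡ f i
  periodic-% f per i = trans (sym (multiple (i / n))) (cong f (sym (m≡m%n+[m/n]*n i n)))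
    where
    multiple : ∀ k → f (i % n ℕ.+ k ℕ.* n) ≡ f (i % n)
    multiple zero    = cong f (ℕₚ.+-identityʳ (i % n))
    multiple (suc k) = trans
      (cong f (trans (cong (i % n ℕ.+_) (ℕₚ.+-comm n (k ℕ.* n))) (sym (ℕₚ.+-assoc (i % n) (k ℕ.* n) n))))
      (trans (per _) (multiple k))

module Cycle {m : ℕ} (2≤m : 2 ≤ m) (B : Mat (suc m)) (π : Permutation′ (suc m))
             (B≡ : ∀ x y → B x y ≡ b2ℤ (cycAdj (π ⟨$⟩ʳ x) (π ⟨$⟩ʳ y))) where
  private
    n = suc m

  index : Fin n → ℕ
  index x = toℕ (π ⟨$⟩ʳ x)

  -- All natural numbers serve as positions, so closing the cycle needs no case distinction.
  vertex : ℕ → Fin n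
  vertex i = π ⟨$⟩ˡ fromℕ< (m%n<n i n)

  index-vertex : ∀ i → index (vertex i) ≡ i % n
  index-vertex i = trans (cong toℕ (inverseʳ π)) (toℕ-fromℕ< (m%n<n i n))

  index-injective : ∀ {x y} → index x ≡ index y → x ≡ y
  index-injective eq = trans (sym (inverseˡ π)) (trans (cong (π ⟨$⟩ˡ_) (toℕ-injective eq)) (inverseˡ π))

  index-% : ∀ x → index x % n ≡ index x
  index-% x = m<n⇒m%n≡m (toℕ<n (π ⟨$⟩ʳ x))

  vertex-index : ∀ x → vertex (index x) ≡ x
  vertex-index x = index-injective (trans (index-vertex (index x)) (index-% x))

  vertex-cong : ∀ i j → i % n ≡ j % n → vertex i ≡ vertex j
  vertex-cong i j eq = index-injective (trans (index-vertex i) (trans eq (sym (index-vertex j))))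

  -- `index x ℕ.+ m` is the position before x modulo n. Writing x as a successor gives both of its
  -- neighbours natural positions.
  vertex-suc : ∀ x → ∃ λ i → vertex (suc i) ≡ x
  vertex-suc x = index x ℕ.+ m ,
    trans (cong vertex (sym (ℕₚ.+-suc (index x) m)))
          (trans (vertex-cong (index x ℕ.+ n) (index x) ([m+n]%n≡m%n (index x) n)) (vertex-index x))

  vertex-ext : ∀ {u v : Fin n → ℤ} → (∀ i → u (vertex i) ≡ v (vertex i)) → u ≗ v
  vertex-ext {u} {v} eq x = subst (λ x → u x ≡ v x) (vertex-index x) (eq (index x))

  B-sym : ∀ x y → B x y ≡ B y x
  B-sym x y = trans (B≡ x y) (trans (cong b2ℤ (cycAdj-sym (π ⟨$⟩ʳ x) (π ⟨$⟩ʳ y))) (sym (B≡ y x)))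

  -- The row is a sum of two indicators because the neighbours are distinct; if they coincided, the
  -- sum would be 2 where B has a 1.
  B-row : ∀ i y → B (vertex (suc i)) y ≡ idM (vertex (suc (suc i))) y + idM (vertex i) y
  B-row i y = trans (B≡ x y) (row (cycAdj-spec (π ⟨$⟩ʳ x) (π ⟨$⟩ʳ y)))
    where
    x = vertex (suc i)

    forward : suc (index x) % n ≡ suc (suc i) % n
    forward = trans (cong (λ w → suc w % n) (index-vertex (suc i))) (suc-%-cong m (suc i))

    distinct : vertex (suc (suc i)) ≢ vertex i
    distinct eq = 2+i≢i m 2≤m i
      (trans (sym (index-vertex (suc (suc i)))) (trans (cong index eq) (index-vertex i)))

    row : ∀ {b} → CycSpec (π ⟨$⟩ʳ x) (π ⟨$⟩ʳ y) b → b2ℤ b ≡ idM (vertex (suc (suc i))) y + idM (vertex i) y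
    row (succ eq) with index-injective (trans (index-vertex (suc (suc i))) (trans (sym forward) eq))
    ... | refl = sym (cong₂ _+_ (idM-diag (vertex (suc (suc i)))) (idM-off distinct))
    row (pred eq) with index-injective (trans (index-vertex i)
      (trans (sym (suc-%-cancel m (index y) i (trans eq (index-vertex (suc i))))) (index-% y)))
    ... | refl = sym (cong₂ _+_ (idM-off (distinct ∘ sym)) (idM-diag (vertex i)))
    row (none ≢succ ≢pred) = sym (cong₂ _+_
      (idM-off {i = vertex (suc (suc i))} {y} λ { refl → ≢succ (trans forward (sym (index-vertex (suc (suc i))))) })
      (idM-off {i = vertex i} {y} λ { refl → ≢pred (trans (cong (λ w → suc w % n) (index-vertex i))
                                   (trans (suc-%-cong m i) (sym (index-vertex (suc i))))) }))

  act-B : ∀ u i → act B u (vertex (suc i)) ≡ u (vertex (suc (suc i))) + u (vertex i)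
  act-B u i = trans
    (sum-cong λ y → trans (cong (_* u y) (B-row i y))
                          (ℤₚ.*-distribʳ-+ (u y) (idM (vertex (suc (suc i))) y) (idM (vertex i) y)))
    (trans (sum-+ (λ y → idM (vertex (suc (suc i))) y * u y) (λ y → idM (vertex i) y * u y))
           (cong₂ _+_ (act-idM u (vertex (suc (suc i)))) (act-idM u (vertex i))))

  module _ (f : ℕ → ℤ) (per : ∀ i → f (i ℕ.+ n) ≡ f i) where

    periodic-vertex : ∀ i → f (index (vertex i)) ≡ f i
    periodic-vertex i = trans (cong f (index-vertex i)) (periodic-% m f per i)

    -- Periodicity lets a solution of the recurrence close up around the cycle. Instances are the
    -- constant 1 (β = 2), `alt` (β = -2), and `cos` and `sin` (β = 0).
    periodic-eigen : ∀ {β} → (∀ i → f (suc (suc i)) + f i ≡ β * f (suc i)) →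
                     ∀ x → act B (f ∘ index) x ≡ β * f (index x)
    periodic-eigen {β} rec x with vertex-suc x
    ... | i , refl = trans (act-B (f ∘ index) i)
      (trans (cong₂ _+_ (periodic-vertex (suc (suc i))) (periodic-vertex i))
        (trans (rec i) (cong (β *_) (sym (periodic-vertex (suc i))))))

  act-B-1 : ∀ x → act B (λ _ → + 1) x ≡ + 2
  act-B-1 = periodic-eigen (λ _ → + 1) (λ _ → refl) {+ 2} (λ _ → refl)

  vertex-n : vertex n ≡ vertex 0
  vertex-n = vertex-cong n 0 ([m+n]%n≡m%n 0 n)

  -- Conversely, the eigenvalue equation is a second-order recurrence along the cycle, so an
  -- eigenvector is determined by its values at vertices 0 and 1.
  eigen-recurrence : ∀ u β → (∀ x → act B u x ≡ β * u x) →
                     ∀ i → u (vertex (suc (suc i))) ≡ β * u (vertex (suc i)) - u (vertex i)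
  eigen-recurrence u β eig i = trans (lemma (u (vertex (suc (suc i)))) (u (vertex i)))
    (cong (_- u (vertex i)) (trans (sym (act-B u i)) (eig (vertex (suc i)))))
    where
    lemma : ∀ x y → x ≡ x + y - y
    lemma = solve-∀

-- cos i and sin i stand for cos(iπ/2) and sin(iπ/2).
alt cos sin : ℕ → ℤ
alt 0 = + 1
alt (suc i) = - alt i
cos 0 = + 1
cos 1 = + 0
cos (suc (suc i)) = - cos i
sin 0 = + 0
sin 1 = + 1
sin (suc (suc i)) = - sin i

module _ {m : ℕ} (2≤m : 2 ≤ m) {B : Mat (suc m)} (π : Permutation′ (suc m))
         (B≡ : ∀ x y → B x y ≡ b2ℤ (cycAdj (π ⟨$⟩ʳ x) (π ⟨$⟩ʳ y))) where
  open Cycle 2≤m B π B≡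

  -- For β = 0 the recurrence reads u(i+2) = -u(i), with `cos` and `sin` as the basis dual to
  -- evaluation at positions 0 and 1.
  kernel-sequence : ∀ u → (∀ x → act B u x ≡ + 0 * u x) →
                    ∀ i → u (vertex i) ≡ u (vertex 0) * cos i + u (vertex 1) * sin i
  kernel-sequence u ker 0 = lemma (u (vertex 0)) (u (vertex 1))
    where
    lemma : ∀ x y → x ≡ x * + 1 + y * + 0
    lemma = solve-∀
  kernel-sequence u ker 1 = lemma (u (vertex 0)) (u (vertex 1))
    where
    lemma : ∀ x y → y ≡ x * + 0 + y * + 1
    lemma = solve-∀
  kernel-sequence u ker (suc (suc i)) = trans (eigen-recurrence u (+ 0) ker i)
    (trans (cong (λ w → + 0 * u (vertex (suc i)) - w) (kernel-sequence u ker i))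
           (lemma (u (vertex (suc i))) (u (vertex 0)) (u (vertex 1)) (cos i) (sin i)))
    where
    lemma : ∀ z x y c s → + 0 * z - (x * c + y * s) ≡ x * - c + y * - s
    lemma = solve-∀

  module _ (u : Fin (suc m) → ℤ) (eig : ∀ x → act B u x ≡ - + 2 * u x) (alt-n : alt (suc m) ≡ + 1) where
    private
      δ = - u (vertex 1) - u (vertex 0)

      -- (−1)^i u_i is an arithmetic progression, and a periodic one is constant.
      drift : ∀ i → u (vertex i) ≡ alt i * (u (vertex 0) + + i * δ)
      drift 0 = lemma (u (vertex 0)) δ
        where
        lemma : ∀ x δ → x ≡ + 1 * (x + + 0 * δ)
        lemma = solve-∀
      drift 1 = lemma (u (vertex 0)) (u (vertex 1))
        where
        lemma : ∀ x y → y ≡ - + 1 * (x + + 1 * (- y - x))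
        lemma = solve-∀
      drift (suc (suc i)) = trans (eigen-recurrence u (- + 2) eig i)
        (trans (cong₂ (λ a b → - + 2 * a - b) (drift (suc i)) (drift i))
               (lemma (alt i) (u (vertex 0)) (+ i) δ))
        where
        lemma : ∀ a x i δ → - + 2 * (- a * (x + (+ 1 + i) * δ)) - a * (x + i * δ)
                              ≡ - - a * (x + (+ 2 + i) * δ)
        lemma = solve-∀

      δ≡0 : δ ≡ + 0
      δ≡0 with i*j≡0⇒i≡0∨j≡0 (+ suc m) n*δ≡0
        where
        x = u (vertex 0)

        lemma : ∀ x y → y ≡ + 1 * (x + y) - x
        lemma = solve-∀

        n*δ≡0 : + suc m * δ ≡ + 0
        n*δ≡0 = trans (lemma x (+ suc m * δ)) (i≡j⇒i-j≡0
          (trans (cong (_* (x + + suc m * δ)) (sym alt-n)) (trans (sym (drift (suc m))) (cong u vertex-n))))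
      ... | inj₂ eq = eq

    -- The eigenspace of B for -2 is thus a line, and A, which preserves it, acts on it by a scalar.
    alternating-sequence : ∀ i → u (vertex i) ≡ u (vertex 0) * alt i
    alternating-sequence i = trans (drift i)
      (trans (cong (λ w → alt i * (u (vertex 0) + + i * w)) δ≡0) (lemma (alt i) (u (vertex 0)) (+ i)))
      where
      lemma : ∀ a x i → a * (x + i * + 0) ≡ x * a
      lemma = solve-∀

-- Graphs with cyclic defect

-- The indicator of the even positions links the integer eigenvalue on `alt` with neighbour counts,
-- and these modulo 2 with the action on `cos` and `sin`.
even : ℕ → ℤ
even 0 = + 1
even 1 = + 0
even (suc (suc i)) = even i

2even≡1+alt : ∀ i → + 2 * even i ≡ + 1 * + 1 + + 1 * alt i
2even≡1+alt 0 = refl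
2even≡1+alt 1 = refl
2even≡1+alt (suc (suc i)) = trans (2even≡1+alt i) (cong (λ w → + 1 + + 1 * w) (sym (ℤₚ.neg-involutive (alt i))))

private
  flip-mod2 : ∀ x c κ → x ≡ c + + 2 * κ → x ≡ - c + + 2 * (c + κ)
  flip-mod2 x c κ eq = trans eq (lemma c κ)
    where
    lemma : ∀ c κ → c + + 2 * κ ≡ - c + + 2 * (c + κ)
    lemma = solve-∀

-- `cos` is ±1 at even and 0 at odd positions, and signs disappear modulo 2.
even≡cos-mod2 : ∀ i → ∃ λ κ → even i ≡ cos i + + 2 * κ
even≡cos-mod2 0 = + 0 , refl
even≡cos-mod2 1 = + 0 , refl
even≡cos-mod2 (suc (suc i)) with even≡cos-mod2 i
... | κ , eq = cos i + κ , flip-mod2 (even i) (cos i) κ eq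

odd≡sin-mod2 : ∀ i → ∃ λ κ → + 1 * + 1 + - + 1 * even i ≡ sin i + + 2 * κ
odd≡sin-mod2 0 = + 0 , refl
odd≡sin-mod2 1 = + 0 , refl
odd≡sin-mod2 (suc (suc i)) with odd≡sin-mod2 i
... | κ , eq = sin i + κ , flip-mod2 (+ 1 * + 1 + - + 1 * even i) (sin i) κ eq

period-4 : ∀ (f : ℕ → ℤ) → (∀ i → f (4 ℕ.+ i) ≡ f i) → ∀ {n} k → n ≡ k ℕ.* 4 → ∀ i → f (i ℕ.+ n) ≡ f i
period-4 f per k refl i = trans (cong f (ℕₚ.+-comm i (k ℕ.* 4))) (go k)
  where
  go : ∀ k → f (k ℕ.* 4 ℕ.+ i) ≡ f i
  go zero    = refl
  go (suc k) = trans (per (k ℕ.* 4 ℕ.+ i)) (go k)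

-- From u = w + 2κ follows M u = M w + 2 M κ; the conclusion is solved for M w, hence the minus sign
-- in the witness.
act-mod2 : ∀ {n} (M : Mat n) u w → (∀ i → ∃ λ κ → u i ≡ w i + + 2 * κ) →
           ∀ x → ∃ λ κ → act M w x ≡ act M u x + + 2 * κ
act-mod2 M u w u≡w x = - act M κ x , trans (lemma (act M w x) (act M κ x))
  (cong (_+ + 2 * - act M κ x)
    (sym (trans (act-congʳ M (λ i → trans (proj₂ (u≡w i)) (cong (_+ + 2 * κ i) (sym (ℤₚ.*-identityˡ (w i))))) x)
                (act-linear M (+ 1) (+ 2) w κ x))))
  where
  κ = proj₁ ∘ u≡w
  lemma : ∀ a k → a ≡ + 1 * a + + 2 * k + + 2 * - k
  lemma = solve-∀

adjMat-row : ∀ {n} (Γ : Graph n) {d} → Regular Γ d → ∀ i → act (adjMat Γ) (λ _ → + 1) i ≡ + d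
adjMat-row Γ reg i = trans (sum-cong λ k → ℤₚ.*-identityʳ (adjMat Γ i k))
                           (trans (sum-b2 (adj Γ i)) (cong +_ (reg i)))

adjMat-sym : ∀ {n} (Γ : Graph n) i j → adjMat Γ i j ≡ adjMat Γ j i
adjMat-sym Γ i j = cong b2ℤ (Graph.sym Γ i j)

module Defect {m : ℕ} (2≤m : 2 ≤ m) (Γ : Graph (suc m)) (d : ℕ) (q : ℤ) (D : ℕ)
              (q≡ : + (d ℕ.∸ 1) ≡ q) (reg : Regular Γ d)
              (B : Mat (suc m)) (π : Permutation′ (suc m))
              (B≡ : ∀ x y → B x y ≡ b2ℤ (cycAdj (π ⟨$⟩ʳ x) (π ⟨$⟩ʳ y)))
              (G≡J+B : ∀ i j → GMat d D (adjMat Γ) i j ≡ (onesM ⊕ B) i j) where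
  open Cycle 2≤m B π B≡ public
  private
    A = adjMat Γ
    V = Fin (suc m) → ℤ

  act-G : ∀ u i → act (GMat d D A) u i ≡ sumℤ u + act B u i
  act-G u i = trans (act-cong {u = u} G≡J+B (λ _ → refl) i)
                    (trans (act-⊕ onesM B u i) (cong (_+ act B u i) (act-onesM u i)))

  -- B = G(A) - J, where A commutes with G(A), a polynomial in A, and with J: A J = d J by
  -- regularity, and J A = d J by symmetry as well.
  A-B-commute : ∀ u → act A (act B u) ≗ act B (act A u)
  A-B-commute u i = begin
    act A (act B u) i                                            ≡⟨ act-congʳ A B≗G-J i ⟩
    act A (λ k → + 1 * act (GMat d D A) u k + - + 1 * sumℤ u) i
      ≡⟨ act-linear A (+ 1) (- + 1) (act (GMat d D A) u) (λ _ → sumℤ u) i ⟩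
    + 1 * act A (act (GMat d D A) u) i + - + 1 * act A (λ _ → sumℤ u) i
      ≡⟨ cong₂ (λ x y → + 1 * x + - + 1 * y)
           (trans (GMat-commutes A d q≡ D u i) (act-G (act A u) i))
           (trans (act-const A (sumℤ u) i) (trans (cong (sumℤ u *_) (adjMat-row Γ reg i)) (ℤₚ.*-comm (sumℤ u) (+ d)))) ⟩
    + 1 * (sumℤ (act A u) + act B (act A u) i) + - + 1 * (+ d * sumℤ u)
      ≡⟨ cong (λ w → + 1 * (w + act B (act A u) i) + - + 1 * (+ d * sumℤ u))
           (sum-act A (+ d) (adjMat-sym Γ) (adjMat-row Γ reg) u) ⟩
    + 1 * (+ d * sumℤ u + act B (act A u) i) + - + 1 * (+ d * sumℤ u)
      ≡⟨ cancel (+ d * sumℤ u) (act B (act A u) i) ⟩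
    act B (act A u) i ∎
    where
    open ≡-Reasoning
    lemma : ∀ S b → b ≡ + 1 * (S + b) + - + 1 * S
    lemma = solve-∀
    cancel : ∀ S b → + 1 * (S + b) + - + 1 * S ≡ b
    cancel S b = sym (lemma S b)
    B≗G-J : ∀ k → act B u k ≡ + 1 * act (GMat d D A) u k + - + 1 * sumℤ u
    B≗G-J k = trans (lemma (sumℤ u) (act B u k)) (cong (λ w → + 1 * w + - + 1 * sumℤ u) (sym (act-G u k)))

  -- Both sides are the value of G(A) = J + B on the all-ones vector, an eigenvector of A for d and
  -- of B for 2.
  order : + suc m + + 2 ≡ g q (+ d) D
  order = begin
    + suc m + + 2
      ≡⟨ cong₂ _+_ (trans (sym (ℤₚ.*-identityʳ (+ suc m))) (sym (sum-const (suc m) (+ 1)))) (sym (act-B-1 zero)) ⟩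
    sumℤ 𝟙 + act B 𝟙 zero             ≡⟨ act-G 𝟙 zero ⟨
    act (GMat d D A) 𝟙 zero
      ≡⟨ GMat-eigen A d q≡ (λ i → trans (adjMat-row Γ reg i) (sym (ℤₚ.*-identityʳ (+ d)))) D zero ⟩
    g q (+ d) D * + 1                 ≡⟨ ℤₚ.*-identityʳ _ ⟩
    g q (+ d) D                       ∎
    where
    open ≡-Reasoning
    𝟙 : V
    𝟙 _ = + 1

  module _ (u : V) (β : ℤ) (eig : ∀ x → act B u x ≡ β * u x) where

    A-preserves : ∀ x → act B (act A u) x ≡ β * act A u x
    A-preserves x = trans (sym (A-B-commute u x)) (trans (act-congʳ A eig x) (act-scale A β u x))

    -- Summing B u = β u over all vertices gives 2 Σu = β Σu, so Σu = 0 and J kills u. The number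
    -- `j` certifies that 2 - β is nonzero: 3 for β = -2 and 1 for β = 0.
    act-G-eigen : ∀ j → + 2 - β ≡ + suc j → ∀ x → act (GMat d D A) u x ≡ β * u x
    act-G-eigen j 2-β≡ x = trans (act-G u x)
      (trans (cong₂ _+_ sum≡0 (eig x)) (ℤₚ.+-identityˡ _))
      where
      factor : ∀ β S → (+ 2 - β) * S ≡ + 2 * S - β * S
      factor = solve-∀
      sum≡0 : sumℤ u ≡ + 0
      sum≡0 with i*j≡0⇒i≡0∨j≡0 (+ suc j) (trans (cong (_* sumℤ u) (sym 2-β≡)) (trans (factor β (sumℤ u))
        (i≡j⇒i-j≡0 (trans (sym (sum-act B (+ 2) B-sym act-B-1 u)) (trans (sum-cong eig) (sum-*ˡ β u))))))
      ... | inj₂ eq = eq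

  module Spectrum (k : ℕ) (n≡4k : suc m ≡ k ℕ.* 4) where
    private
      neg⁴ : ∀ x → - - - - x ≡ x
      neg⁴ x = trans (ℤₚ.neg-involutive (- - x)) (ℤₚ.neg-involutive x)

      alt-per : ∀ i → alt (i ℕ.+ suc m) ≡ alt i
      alt-per = period-4 alt (λ i → neg⁴ (alt i)) k n≡4k

      cos-per : ∀ i → cos (i ℕ.+ suc m) ≡ cos i
      cos-per = period-4 cos (λ i → ℤₚ.neg-involutive (cos i)) k n≡4k

      sin-per : ∀ i → sin (i ℕ.+ suc m) ≡ sin i
      sin-per = period-4 sin (λ i → ℤₚ.neg-involutive (sin i)) k n≡4k

      altV cosV sinV evenV oddV : V
      altV  = alt ∘ index
      cosV  = cos ∘ index
      sinV  = sin ∘ index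
      evenV = even ∘ index
      oddV x = + 1 * + 1 + - + 1 * evenV x

    alt-eigen : ∀ x → act B altV x ≡ - + 2 * altV x
    alt-eigen = periodic-eigen alt alt-per { - + 2} (λ i → lemma (alt i))
      where
      lemma : ∀ a → - - a + a ≡ - + 2 * - a
      lemma = solve-∀

    cos-kernel : ∀ x → act B cosV x ≡ + 0 * cosV x
    cos-kernel = periodic-eigen cos cos-per {+ 0} (λ i → ℤₚ.+-inverseˡ (cos i))

    sin-kernel : ∀ x → act B sinV x ≡ + 0 * sinV x
    sin-kernel = periodic-eigen sin sin-per {+ 0} (λ i → ℤₚ.+-inverseˡ (sin i))

    -- The scalar λ by which A acts on `altV`, read off where `altV` is 1.
    eigenvalue : ℤ
    eigenvalue = act A altV (vertex 0)

    A-alt : ∀ x → act A altV x ≡ eigenvalue * altV x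
    A-alt = vertex-ext λ i → trans
      (alternating-sequence 2≤m π B≡ (act A altV) (A-preserves altV (- + 2) alt-eigen) (alt-per 0) i)
      (cong (eigenvalue *_) (sym (periodic-vertex alt alt-per i)))

    g[eigenvalue] : g q eigenvalue D ≡ - + 2
    g[eigenvalue] = begin
      g q eigenvalue D                     ≡⟨ ℤₚ.*-identityʳ _ ⟨
      g q eigenvalue D * + 1               ≡⟨ cong (g q eigenvalue D *_) (periodic-vertex alt alt-per 0) ⟨
      g q eigenvalue D * altV (vertex 0)   ≡⟨ GMat-eigen A d q≡ A-alt D (vertex 0) ⟨
      act (GMat d D A) altV (vertex 0)     ≡⟨ act-G-eigen altV (- + 2) alt-eigen 3 refl (vertex 0) ⟩
      - + 2 * altV (vertex 0)              ≡⟨ cong (- + 2 *_) (periodic-vertex alt alt-per 0) ⟩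
      - + 2                                ∎
      where open ≡-Reasoning

    -- The columns (a, b) and (b′, c) of M: at vertices 0 and 1, `cosV` takes the values 1, 0 and
    -- `sinV` the values 0, 1, so evaluation there yields coordinates.
    a b b′ c : ℤ
    a  = act A cosV (vertex 0)
    b  = act A cosV (vertex 1)
    b′ = act A sinV (vertex 0)
    c  = act A sinV (vertex 1)

    private
      in-plane : ∀ u → (∀ x → act B u x ≡ + 0 * u x) →
                 ∀ x → act A u x ≡ act A u (vertex 0) * cosV x + act A u (vertex 1) * sinV x
      in-plane u ker = vertex-ext λ i → trans
        (kernel-sequence 2≤m π B≡ (act A u) (A-preserves u (+ 0) ker) i)
        (sym (cong₂ (λ x y → act A u (vertex 0) * x + act A u (vertex 1) * y)
                    (periodic-vertex cos cos-per i) (periodic-vertex sin sin-per i)))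

    module _ (e f : ℤ) (u : V) (u≗ : ∀ x → u x ≡ e * cosV x + f * sinV x)
             (ker : ∀ x → act B u x ≡ + 0 * u x) where
      open Planar q a b b′ c e f

      private
        -- On the kernel of B both J and B act as zero, hence so does G(A). Evaluation at vertices 0
        -- and 1 then isolates `gx D` and `gy D`.
        vanish : ∀ x → gx D * cosV x + gy D * sinV x ≡ + 0
        vanish x = trans (sym (GMat-plane A d q≡ (in-plane cosV cos-kernel) (in-plane sinV sin-kernel) e f u≗ D x))
                         (act-G-eigen u (+ 0) ker 1 refl x)

      gx≡0 : gx D ≡ + 0
      gx≡0 = trans (lemma (gx D) (gy D))
        (trans (cong₂ (λ x y → gx D * x + gy D * y) (sym (periodic-vertex cos cos-per 0)) (sym (periodic-vertex sin sin-per 0)))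
               (vanish (vertex 0)))
        where
        lemma : ∀ x y → x ≡ x * + 1 + y * + 0
        lemma = solve-∀

      gy≡0 : gy D ≡ + 0
      gy≡0 = trans (lemma (gx D) (gy D))
        (trans (cong₂ (λ x y → gx D * x + gy D * y) (sym (periodic-vertex cos cos-per 1)) (sym (periodic-vertex sin sin-per 1)))
               (vanish (vertex 1)))
        where
        lemma : ∀ x y → y ≡ x * + 0 + y * + 1
        lemma = solve-∀

    -- The number of neighbours of `vertex 0` at even positions; it witnesses that λ + d is even.
    t : ℤ
    t = act A evenV (vertex 0)

    private
      2A-even : ∀ x → + 2 * act A evenV x ≡ + d + eigenvalue * altV x
      2A-even x = begin
        + 2 * act A evenV x                                    ≡⟨ act-scale A (+ 2) evenV x ⟨
        act A (λ y → + 2 * evenV y) x                          ≡⟨ act-congʳ A (λ y → 2even≡1+alt (index y)) x ⟩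
        act A (λ y → + 1 * + 1 + + 1 * altV y) x               ≡⟨ act-linear A (+ 1) (+ 1) (λ _ → + 1) altV x ⟩
        + 1 * act A (λ _ → + 1) x + + 1 * act A altV x
          ≡⟨ cong₂ _+_ (trans (ℤₚ.*-identityˡ _) (adjMat-row Γ reg x)) (trans (ℤₚ.*-identityˡ _) (A-alt x)) ⟩
        + d + eigenvalue * altV x                              ∎
        where open ≡-Reasoning

      2t : + 2 * t ≡ + d + eigenvalue * + 1
      2t = trans (2A-even (vertex 0)) (cong (λ w → + d + eigenvalue * w) (periodic-vertex alt alt-per 0))

      -- Position 1 carries the sign -1, so twice the count is d - λ = 2d - 2t.
      A-even-1 : act A evenV (vertex 1) ≡ + d - t
      A-even-1 = ℤₚ.*-cancelˡ-≡ (+ 2) _ _ (begin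
        + 2 * act A evenV (vertex 1)
          ≡⟨ trans (2A-even (vertex 1)) (cong (λ w → + d + eigenvalue * w) (periodic-vertex alt alt-per 1)) ⟩
        + d + eigenvalue * - + 1                       ≡⟨ lemma (+ d) eigenvalue ⟩
        + 2 * + d - (+ d + eigenvalue * + 1)           ≡⟨ cong (λ w → + 2 * + d - w) 2t ⟨
        + 2 * + d - + 2 * t                            ≡⟨ lemma′ (+ d) t ⟩
        + 2 * (+ d - t)                                ∎)
        where
        open ≡-Reasoning
        lemma : ∀ d λ′ → d + λ′ * - + 1 ≡ + 2 * d - (d + λ′ * + 1)
        lemma = solve-∀
        lemma′ : ∀ d t → + 2 * d - + 2 * t ≡ + 2 * (d - t)
        lemma′ = solve-∀

      A-odd : ∀ x → act A oddV x ≡ + d - act A evenV x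
      A-odd x = trans (act-linear A (+ 1) (- + 1) (λ _ → + 1) evenV x)
        (trans (cong (λ w → + 1 * w + - + 1 * act A evenV x) (adjMat-row Γ reg x)) (lemma (+ d) (act A evenV x)))
        where
        lemma : ∀ d x → + 1 * d + - + 1 * x ≡ d - x
        lemma = solve-∀

      even≡cos : ∀ x → ∃ λ κ → act A cosV x ≡ act A evenV x + + 2 * κ
      even≡cos = act-mod2 A evenV cosV (even≡cos-mod2 ∘ index)

      odd≡sin : ∀ x → ∃ λ κ → act A sinV x ≡ act A oddV x + + 2 * κ
      odd≡sin = act-mod2 A oddV sinV (odd≡sin-mod2 ∘ index)

      retarget : ∀ {x y z} → (∃ λ κ → x ≡ y + + 2 * κ) → y ≡ z → ∃ λ κ → x ≡ z + + 2 * κ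
      retarget r refl = r

    eigenvalue≡ : eigenvalue ≡ - + d + + 2 * t
    eigenvalue≡ = trans (lemma (+ d) eigenvalue) (cong (λ w → - + d + w) (sym 2t))
      where
      lemma : ∀ d x → x ≡ - d + (d + x * + 1)
      lemma = solve-∀

    a≡t : ∃ λ κ → a ≡ t + + 2 * κ
    a≡t = even≡cos (vertex 0)

    b≡d-t : ∃ λ κ → b ≡ + d - t + + 2 * κ
    b≡d-t = retarget (even≡cos (vertex 1)) A-even-1

    b′≡d-t : ∃ λ κ → b′ ≡ + d - t + + 2 * κ
    b′≡d-t = retarget (odd≡sin (vertex 0)) (A-odd (vertex 0))

    c≡t : ∃ λ κ → c ≡ t + + 2 * κ
    c≡t = retarget (odd≡sin (vertex 1)) (trans (A-odd (vertex 1)) (trans (cong (λ w → + d - w) A-even-1) (lemma (+ d) t)))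
      where
      lemma : ∀ d t → d - (d - t) ≡ t
      lemma = solve-∀

    e₁≗ : ∀ x → cosV x ≡ + 1 * cosV x + + 0 * sinV x
    e₁≗ x = lemma (cosV x) (sinV x)
      where
      lemma : ∀ x y → x ≡ + 1 * x + + 0 * y
      lemma = solve-∀

    e₂≗ : ∀ x → sinV x ≡ + 0 * cosV x + + 1 * sinV x
    e₂≗ x = lemma (cosV x) (sinV x)
      where
      lemma : ∀ x y → y ≡ + 0 * x + + 1 * y
      lemma = solve-∀

-- Contradiction for odd degree and the diameters in question

module _ {m : ℕ} (2≤m : 2 ≤ m) (Γ : Graph (suc m)) (d : ℕ) (s : ℤ) (M : ℕ)
         (q≡ : + (d ℕ.∸ 1) ≡ + 2 * s) (d≡ : + d ≡ + 1 + + 2 * s) (reg : Regular Γ d)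
         (B : Mat (suc m)) (π : Permutation′ (suc m))
         (B≡ : ∀ x y → B x y ≡ b2ℤ (cycAdj (π ⟨$⟩ʳ x) (π ⟨$⟩ʳ y)))
         (G≡J+B : ∀ i j → GMat d (suc M) (adjMat Γ) i j ≡ (onesM ⊕ B) i j)
         (64∣ : ∃ λ z → (- (+ 2 * s)) ^ suc M ≡ + 64 * z)
         (h≡1 : ∀ j → ∃ λ i → h[-d] s (+ 1 + + 4 * j) (suc M) ≡ + 1 + + 4 * i)
         (h≡5 : ∀ j → ∃ λ i → h[-d] s (- + 1 + + 8 * j) (suc M) ≡ + 5 + + 8 * i)
         (gd : ∃ λ k → g (+ 2 * s) (+ 1 + + 2 * s) (suc M) ≡ + 2 + + 4 * k)
         where
  private
    D = suc M
    q = + 2 * s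
  open Defect 2≤m Γ d q D q≡ reg B π B≡ G≡J+B

  4∣order : ∃ λ k → suc m ≡ k ℕ.* 4
  -- The quotient (G(d) - 2) / 4 is known as an integer; its absolute value gives the natural number
  -- required.
  4∣order = ∣ proj₁ gd ∣ ,
    trans (cong ∣_∣ n≡4k) (trans (ℤₚ.abs-* (+ 4) (proj₁ gd)) (ℕₚ.*-comm 4 ∣ proj₁ gd ∣))
    where
    lemma : ∀ n → n ≡ n + + 2 - + 2
    lemma = solve-∀
    lemma′ : ∀ k → + 2 + + 4 * k - + 2 ≡ + 4 * k
    lemma′ = solve-∀
    n≡4k : + suc m ≡ + 4 * proj₁ gd
    n≡4k = trans (lemma (+ suc m))
      (trans (cong (_- + 2) (trans order (trans (cong (λ x → g q x D) d≡) (proj₂ gd)))) (lemma′ (proj₁ gd)))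

  noCyclicDefect : ⊥
  noCyclicDefect = no-spectrum s M 64∣ h≡1 h≡5 t a b b′ c a≡t (at-d b≡d-t) (at-d b′≡d-t) c≡t
    (trans (cong (λ x → g q x D) (sym (trans eigenvalue≡ (cong (λ w → - w + + 2 * t) d≡)))) g[eigenvalue])
    (gx≡0 (+ 1) (+ 0) _ e₁≗ cos-kernel) (gy≡0 (+ 1) (+ 0) _ e₁≗ cos-kernel)
    (gx≡0 (+ 0) (+ 1) _ e₂≗ sin-kernel) (gy≡0 (+ 0) (+ 1) _ e₂≗ sin-kernel)
    where
    open Spectrum (proj₁ 4∣order) (proj₂ 4∣order)

    at-d : ∀ {x} → (∃ λ κ → x ≡ + d - t + + 2 * κ) → ∃ λ κ → x ≡ + 1 + q - t + + 2 * κ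
    at-d (κ , eq) = κ , trans eq (cong (λ w → w - t + + 2 * κ) d≡)

theorem3 : (n d D : ℕ) → (Γ : Graph n) → d % 2 ≡ 1 → D % 6 ≡ 0 →
    ¬ CyclicDefect Γ d D
theorem3 (suc m) d D Γ d-odd 6∣D (s≤s 2≤m , reg , _ , 2≤D , _ , B , (π , B≡) , G≡J+B) =
  go (d / 2) (trans (m≡m%n+[m/n]*n d 2) (cong (ℕ._+ d / 2 ℕ.* 2) d-odd))
     (shape (D / 6) (trans (m≡m%n+[m/n]*n D 6) (cong (ℕ._+ D / 6 ℕ.* 6) 6∣D)))
  where
  shape : ∀ j → D ≡ j ℕ.* 6 → ∃ λ k → D ≡ suc (5 ℕ.+ k ℕ.* 2)
  shape zero    D≡0 = contradiction (subst (2 ≤_) D≡0 2≤D) λ ()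
  -- 6(j + 1) = 6 + 2 · 3j: an even diameter with at least six factors q in q^D.
  shape (suc j) D≡  = j ℕ.* 3 , trans D≡ (cong (6 ℕ.+_) (sym (ℕₚ.*-assoc j 3 2)))

  go : ∀ r → d ≡ suc (r ℕ.* 2) → (∃ λ k → D ≡ suc (5 ℕ.+ k ℕ.* 2)) → ⊥
  go r d≡ (k , D≡) = noCyclicDefect 2≤m Γ d (+ r) (5 ℕ.+ k ℕ.* 2)
    (trans (cong (λ d → + (d ℕ.∸ 1)) d≡) 2r) (trans (cong +_ d≡) (cong (λ w → + 1 + w) 2r)) reg B π B≡
    (subst (λ D → ∀ i j → GMat d D (adjMat Γ) i j ≡ (onesM ⊕ B) i j) D≡ G≡J+B)
    -- Each argument is chosen so that its lemma lands definitionally on D = 6 + 2k: as 6 + 2k, 1 +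
    -- (5 + 2k), 4 + 2(k + 1) and 2 + (4 + 2k).
    (64∣[-q]^m (+ r) (k ℕ.* 2)) (λ j → h≡1mod4 (+ r) j (5 ℕ.+ k ℕ.* 2))
    (λ j → proj₂ (h≡5mod8 (+ r) j (suc k))) (g[d]≡2mod4 (+ r) (4 ℕ.+ k ℕ.* 2))
    where
    2r : + (r ℕ.* 2) ≡ + 2 * + r
    2r = trans (cong +_ (ℕₚ.*-comm r 2)) (ℤₚ.pos-* 2 r)
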